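{- For every $0<\delta<1$ and integers $s\geq 2$, $q\geq 0$, there is a constant $c=c(s,q,\delta)>0$ such that for all sufficiently large $n$ there is a collection $\mathcal{G}$ of multigraphs with vertex set $[n]$ and multiplicity at most $q$ such that: (i) for every $J\in F(n,s,q)$ there is $G\in\mathcal{G}$ such that $J$ is a submultigraph of $G$; (ii) for every $G\in\mathcal{G}$, $|\mathcal{H}(G,s,q)|\leq\delta\binom{n}{s}$; (iii) $\log|\mathcal{G}|\leq c\,n^{2-\frac{1}{4s}}\log n$.
   Context: A multigraph is a pair $(V,w)$ with $w:\binom{V}{2}\to\mathbb{N}$. Its multiplicity is $\mu(G)=\max_{xy}w(xy)$, and $S(G)=\sum_{xy\in\binom V2}w(xy)$. For $X\subseteq V$, $G[X]=(X,w|_{\binom X2})$. $(V,w)$ is a submultigraph of $(V',w')$ if $V=V'$ and $w(xy)\le w'(xy)$ for all pairs. Two multigraphs are isomorphic if there is a bijection of vertex sets preserving $w$. A multigraph is an $(s,q)$-graph if every $s$-element vertex set $X$ has $S(G[X])\le q$; $F(n,s,q)$ is the set of $(s,q)$-graphs on $[n]$. $\mathcal{H}(s,q)=\{G=([s],w):\mu(G)\le q,\ S(G)>q\}$ and, for a multigraph $G=(V,w)$, $\mathcal{H}(G,s,q)$ is the set of $X\in\binom{V}{s}$ such that $G[X]$ is isomorphic to some member of $\mathcal{H}(s,q)$. Logarithms are natural. -}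

module Defs where

open import Data.Nat using (ℕ; zero; suc; _+_; _*_; _∸_; _^_; _≤_; _<_)
open import Data.Nat.Combinatorics using (_C_)
open import Data.Fin using (Fin; toℕ)
open import Data.Fin.Subset using (Subset; _∈_; ∣_∣)
open import Data.Fin.Subset.Properties using (_∈?_)
open import Data.List using (List; map; allFin; length)
open import Data.Nat.ListAction using (sum)
open import Data.List.Relation.Unary.All using (All)
open import Data.List.Relation.Unary.Unique.Propositional using (Unique)
open import Data.Product using (Σ; _×_; ∃-syntax)
open import Data.Bool using (if_then_else_; _∧_)
open import Relation.Nullary using (does)
open import Relation.Binary.PropositionalEquality using (_≡_; _≢_)
open import Function.Definitions using (Injective)
open import Data.Integer using (+_)
open import Data.Rational using (ℚ; _/_) renaming (_≤_ to _≤ℚ_; _*_ to _*ℚ_)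
import Data.Nat.Properties as ℕP

-- A multigraph on the vertex set [n] = Fin n.  The weight function is
-- symmetric; only its values on pairs i ≠ j (unordered pairs) matter
-- (the diagonal is never used).
record Multigraph (n : ℕ) : Set where
  field
    w   : Fin n → Fin n → ℕ
    sym : ∀ i j → w i j ≡ w j i
open Multigraph public

MultAtMost : ∀ {n} → ℕ → Multigraph n → Set
MultAtMost q G = ∀ i j → i ≢ j → w G i j ≤ q

S : ∀ {n} → Multigraph n → ℕ
S {n} G = sum (map (λ i → sum (map (λ j →
            if does (toℕ i ℕP.<? toℕ j) then w G i j else 0) (allFin n))) (allFin n))

S[_] : ∀ {n} → Multigraph n → Subset n → ℕ
S[_] {n} G X = sum (map (λ i → sum (map (λ j →
            if does (toℕ i ℕP.<? toℕ j) ∧ does (i ∈? X) ∧ does (j ∈? X)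
            then w G i j else 0) (allFin n))) (allFin n))

IsSQGraph : ∀ {n} → ℕ → ℕ → Multigraph n → Set
IsSQGraph {n} s q G = ∀ (X : Subset n) → ∣ X ∣ ≡ s → S[ G ] X ≤ q

_⊑_ : ∀ {n} → Multigraph n → Multigraph n → Set
J ⊑ G = ∀ i j → i ≢ j → w J i j ≤ w G i j

InHsq : ∀ {s} → ℕ → Multigraph s → Set
InHsq q H = MultAtMost q H × q < S H

pull : ∀ {n s} → Multigraph n → (Fin s → Fin n) → Multigraph s
pull G f = record { w = λ a b → w G (f a) (f b) ; sym = λ a b → sym G (f a) (f b) }

-- X ∈ H(G,s,q): |X| = s and G[X] is isomorphic to some member of H(s,q),
-- i.e. there is a bijection f : [s] → X (injective, image in X, |X| = s)
-- such that the multigraph on [s] transported along f lies in H(s,q).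
InH : ∀ {n} → Multigraph n → ℕ → ℕ → Subset n → Set
InH {n} G s q X =
  ∣ X ∣ ≡ s ×
  ∃[ f ] (Injective _≡_ _≡_ f × (∀ a → f a ∈ X) × InHsq q (pull {n} {s} G f))

ℕtoℚ : ℕ → ℚ
ℕtoℚ m = (+ m) / 1

-- |H(G,s,q)| ≤ δ · (n choose s): every duplicate-free list of members of
-- H(G,s,q) has length at most δ · (n choose s).
HBound : ∀ {n} → ℚ → ℕ → ℕ → Multigraph n → Set
HBound {n} δ s q G =
  ∀ (L : List (Subset n)) → Unique L → All (InH G s q) L →
  ℕtoℚ (length L) ≤ℚ δ *ℚ ℕtoℚ (n C s)

{-# OPTIONS --safe #-}
module Submission where

-- Start from the complete multigraph of weight q.  While a container G has many s-tuples of weight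
-- exceeding q, the pairs on which J ⊑ G attains the weight of G form a graph I without a clique on
-- any of those tuples.  So it suffices to cover all such I by boundedly costly choices of a set R of
-- at least c n² pairs avoiding I: lowering G by one on R can be repeated only boundedly often.
--
-- For a dense set D of (j+1)-tuples carrying no clique of I, keep a set H of j-tuples carrying no
-- clique of I.  With t about n^(1/4s), while some vertex u has more than (n/t)^j new tuples of its link
-- inside its neighbourhood, reveal that neighbourhood (n choices of a bit) and add these tuples to H;
-- this happens at most t^j + 1 times.  If H becomes dense, recurse on it.  Otherwise a positive
-- proportion of the links is still dense after removing H, and each neighbourhood spans few tuples of
-- its own link; such a neighbourhood is, up to n/t listed vertices, disjoint from a linear-sized set
-- determined by fewer than j vertices.  The total cost is O(n²/t) choices of a vertex.

open import Defs hiding (sym)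
open import Data.Bool using (Bool; true; false; T; not; _∧_; _∨_; if_then_else_; T?)
open import Data.Bool.Properties using (T-∧; T-∨; ∨-comm; ∧-comm)
open import Data.Empty using (⊥-elim)
open import Data.Fin using (Fin; zero; suc; toℕ; inject≤)
open import Data.Fin.Permutation.Components using (transpose; transpose-inverse)
open import Data.Fin.Properties using (any?; toℕ-injective; inject≤-injective) renaming (_≟_ to _≟ᶠ_)
open import Data.Fin.Subset using (Subset; _∈_; _⊆_; _∪_; ⁅_⁆; ∣_∣) renaming (⊥ to ∅)
open import Data.Fin.Subset.Properties using (_∈?_; ∉⊥; ∣⊥∣≡0; x∈⁅x⁆; x∈⁅y⁆⇒x≡y; ∣⁅x⁆∣≡1; p⊂q⇒∣p∣<∣q∣; q⊆p∪q; x∈p∪q⁺; x∈p∪q⁻; ⊆-antisym)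
open import Data.Integer as ℤ using (-[1+_]) renaming (+_ to pos)
import Data.Integer.Properties as ℤP
open import Data.List using (List; []; _∷_; _++_; map; allFin; length; concatMap)
open import Data.List.Membership.Propositional using (lose) renaming (_∈_ to _∈ˡ_)
open import Data.List.Membership.Propositional.Properties using (∈-∃++; ∈-++⁻; ∈-++⁺ˡ; ∈-++⁺ʳ; ∈-allFin; ∈-concatMap⁺; ∈-map⁺)
open import Data.List.Properties using (length-tabulate; length-++; map-++; length-map)
open import Data.List.Relation.Unary.All as ListAll using (All; []; _∷_)
import Data.List.Relation.Unary.All.Properties as AllP
open import Data.List.Relation.Unary.AllPairs using ([]; _∷_)
open import Data.List.Relation.Unary.Any as Any using (Any; here; there)
import Data.List.Relation.Unary.Any.Properties as AnyP
open import Data.List.Relation.Unary.Unique.Propositional using (Unique)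
import Data.List.Relation.Unary.Unique.Propositional.Properties as UniqueP
open import Data.Nat using (ℕ; zero; suc; _+_; _*_; _∸_; _^_; _≤_; _<_; _≤ᵇ_; z≤n; s≤s; NonZero; >-nonZero; _≤?_; _<?_; _<ᵇ_; >-nonZero⁻¹)
open import Data.Nat.Combinatorics using (_C_; nCk+nC[k+1]≡[n+1]C[k+1]; nC1≡n)
open import Data.Nat.DivMod using (_/_; _%_; m/n*n≤m; m≡m%n+[m/n]*n; m%n<n)
open import Data.Nat.ListAction using (sum)
open import Data.Nat.ListAction.Properties using (sum-++)
open import Data.Nat.Properties
open import Data.Nat.Tactic.RingSolver using (solve-∀)
open import Data.Product using (_×_; _,_; ∃-syntax; proj₁; proj₂)
open import Data.Rational using (ℚ; mkℚ; 0ℚ; *<*; 1ℚ; ↧ₙ_) renaming (_≤_ to _≤ℚ_; _*_ to _*ℚ_; _<_ to _<ℚ_)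
import Data.Rational.Properties as ℚP
open import Data.Rational.Unnormalised using (mkℚᵘ; *≤*)
import Data.Rational.Unnormalised.Properties as ℚᵘP
open import Data.Sum using (inj₁; inj₂; _⊎_)
open import Data.Unit using (tt)
open import Data.Vec using (Vec; []; _∷_; lookup; tabulate)
open import Data.Vec.Properties using (lookup∘tabulate)
open import Data.Vec.Relation.Unary.All as VecAll using ([]; _∷_)
import Data.Vec.Relation.Unary.All.Properties as VecAllP
open import Data.Vec.Relation.Unary.AllPairs as VecPairs using ([]; _∷_)
open import Data.Vec.Relation.Unary.Unique.Propositional using () renaming (Unique to UniqueVec)
import Data.Vec.Relation.Unary.Unique.Propositional.Properties as UniqueVecP
open import Function using (_∘_; Equivalence)
open import Function.Definitions using (Injective)
open import Relation.Binary using (tri<; tri≈; tri>)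
open import Relation.Binary.PropositionalEquality using (_≡_; _≢_; refl; sym; trans; cong; cong₂; subst; module ≡-Reasoning; _≗_)
open import Relation.Nullary using (Dec; yes; no; ¬_; does; _×-dec_; ¬?)
open import Relation.Nullary.Decidable using (dec-true; dec-false; toWitness; fromWitness; ⌊_⌋)

private variable
  A B Y : Set

-- Weighted counting

sumOf : (A → ℕ) → List A → ℕ
sumOf f xs = sum (map f xs)

sumOf-mono : {f g : A → ℕ} → (∀ x → f x ≤ g x) → ∀ xs → sumOf f xs ≤ sumOf g xs
sumOf-mono h []       = z≤n
sumOf-mono h (x ∷ xs) = +-mono-≤ (h x) (sumOf-mono h xs)

sumOf-cong : {f g : A → ℕ} → (∀ x → f x ≡ g x) → ∀ xs → sumOf f xs ≡ sumOf g xs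
sumOf-cong h []       = refl
sumOf-cong h (x ∷ xs) = cong₂ _+_ (h x) (sumOf-cong h xs)

sumOf-+ : (f g : A → ℕ) → ∀ xs → sumOf (λ x → f x + g x) xs ≡ sumOf f xs + sumOf g xs
sumOf-+ f g []       = refl
sumOf-+ f g (x ∷ xs) rewrite sumOf-+ f g xs = interchange (f x) (g x) (sumOf f xs) (sumOf g xs)
  where
  interchange : ∀ a b c d → a + b + (c + d) ≡ a + c + (b + d)
  interchange = solve-∀

sumOf-*ˡ : ∀ c (f : A → ℕ) xs → sumOf (λ x → c * f x) xs ≡ c * sumOf f xs
sumOf-*ˡ c f []       = sym (*-zeroʳ c)
sumOf-*ˡ c f (x ∷ xs) rewrite sumOf-*ˡ c f xs = sym (*-distribˡ-+ c (f x) (sumOf f xs))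

sumOf-const : ∀ c (xs : List A) → sumOf (λ _ → c) xs ≡ length xs * c
sumOf-const c []       = refl
sumOf-const c (x ∷ xs) = cong (c +_) (sumOf-const c xs)

sumOf-swap : (f : A → B → ℕ) → ∀ xs ys →
  sumOf (λ x → sumOf (f x) ys) xs ≡ sumOf (λ y → sumOf (λ x → f x y) xs) ys
sumOf-swap f []       ys = sym (trans (sumOf-const 0 ys) (*-zeroʳ (length ys)))
sumOf-swap f (x ∷ xs) ys rewrite sumOf-swap f xs ys =
  sym (sumOf-+ (f x) (λ y → sumOf (λ z → f z y) xs) ys)

sumOf-++ : (f : A → ℕ) → ∀ xs ys → sumOf f (xs ++ ys) ≡ sumOf f xs + sumOf f ys
sumOf-++ f xs ys = trans (cong sum (map-++ f xs ys)) (sum-++ (map f xs) (map f ys))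

sumOf-concatMap : (f : B → ℕ) (g : A → List B) → ∀ xs →
  sumOf f (concatMap g xs) ≡ sumOf (λ x → sumOf f (g x)) xs
sumOf-concatMap f g []       = refl
sumOf-concatMap f g (x ∷ xs) =
  trans (sumOf-++ f (g x) (concatMap g xs)) (cong (sumOf f (g x) +_) (sumOf-concatMap f g xs))

sumOf-map : (f : B → ℕ) (g : A → B) → ∀ xs → sumOf f (map g xs) ≡ sumOf (f ∘ g) xs
sumOf-map f g []       = refl
sumOf-map f g (x ∷ xs) = cong (f (g x) +_) (sumOf-map f g xs)

-- Delete one occurrence of the head `x` from `ys`. As `x` does not recur in `xs`, the rest of `xs`
-- still lies in what remains of `ys`.
sumOf-unique-⊆ : (f : A → ℕ) → ∀ {xs} → Unique xs → ∀ ys → (∀ {x} → x ∈ˡ xs → x ∈ˡ ys) →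
  sumOf f xs ≤ sumOf f ys
sumOf-unique-⊆ f []           ys sub = z≤n
sumOf-unique-⊆ f {x ∷ xs} (x∉ ∷ u) ys sub with ∈-∃++ (sub (here refl))
... | as , bs , refl = begin
  f x + sumOf f xs              ≤⟨ +-monoʳ-≤ (f x) (sumOf-unique-⊆ f u (as ++ bs) sub′) ⟩
  f x + sumOf f (as ++ bs)      ≡⟨ cong (f x +_) (sumOf-++ f as bs) ⟩
  f x + (sumOf f as + sumOf f bs) ≡⟨ swap (f x) (sumOf f as) (sumOf f bs) ⟩
  sumOf f as + (f x + sumOf f bs) ≡⟨ sumOf-++ f as (x ∷ bs) ⟨
  sumOf f (as ++ x ∷ bs)        ∎
  where
  open ≤-Reasoning
  swap : ∀ a b c → a + (b + c) ≡ b + (a + c)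
  swap = solve-∀
  sub′ : ∀ {y} → y ∈ˡ xs → y ∈ˡ as ++ bs
  sub′ {y} y∈ with ∈-++⁻ as (sub (there y∈))
  ... | inj₁ y∈as         = ∈-++⁺ˡ y∈as
  ... | inj₂ (here refl)  = ⊥-elim (ListAll.lookup x∉ y∈ refl)
  ... | inj₂ (there y∈bs) = ∈-++⁺ʳ as y∈bs

∑ : ∀ {n} → (Fin n → ℕ) → ℕ
∑ {n} f = sumOf f (allFin n)

∑-const : ∀ n c → ∑ {n} (λ _ → c) ≡ n * c
∑-const n c = trans (sumOf-const c (allFin n)) (cong (_* c) (length-tabulate {n = n} _))

∑-mono : ∀ {n} {f g : Fin n → ℕ} → (∀ x → f x ≤ g x) → ∑ f ≤ ∑ g
∑-mono {n} h = sumOf-mono h (allFin n)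

∑-≤ : ∀ {n} {f : Fin n → ℕ} {b} → (∀ x → f x ≤ b) → ∑ f ≤ n * b
∑-≤ {n} {b = b} h = ≤-trans (∑-mono h) (≤-reflexive (∑-const n b))

𝟙 : Bool → ℕ
𝟙 true  = 1
𝟙 false = 0

𝟙≤1 : ∀ b → 𝟙 b ≤ 1
𝟙≤1 true  = ≤-refl
𝟙≤1 false = z≤n

∣_∣ᵇ : ∀ {n} → (Fin n → Bool) → ℕ
∣ W ∣ᵇ = ∑ (𝟙 ∘ W)

-- Splitting off the first coordinate makes `cnt (suc j) D` by definition the sum, over all
-- vertices, of the sizes of their links.
cnt : ∀ {n} j → (Vec (Fin n) j → Bool) → ℕ
cnt zero    D = 𝟙 (D [])
cnt (suc j) D = ∑ λ x → cnt j (λ v → D (x ∷ v))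

cnt-mono-+ : ∀ {n} j {D E F : Vec (Fin n) j → Bool} →
  (∀ v → 𝟙 (D v) ≤ 𝟙 (E v) + 𝟙 (F v)) → cnt j D ≤ cnt j E + cnt j F
cnt-mono-+ zero    h = h []
cnt-mono-+ {n} (suc j) {D} {E} {F} h = ≤-trans (∑-mono (λ x → cnt-mono-+ j (λ v → h (x ∷ v))))
  (≤-reflexive (sumOf-+ (λ x → cnt j (λ v → E (x ∷ v))) (λ x → cnt j (λ v → F (x ∷ v))) (allFin n)))

cnt-+-mono : ∀ {n} j {D E F : Vec (Fin n) j → Bool} →
  (∀ v → 𝟙 (E v) + 𝟙 (F v) ≤ 𝟙 (D v)) → cnt j E + cnt j F ≤ cnt j D
cnt-+-mono zero    h = h []
cnt-+-mono {n} (suc j) {D} {E} {F} h = ≤-trans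
  (≤-reflexive (sym (sumOf-+ (λ x → cnt j (λ v → E (x ∷ v))) (λ x → cnt j (λ v → F (x ∷ v))) (allFin n))))
  (∑-mono (λ x → cnt-+-mono j (λ v → h (x ∷ v))))

cnt≤n^j : ∀ {n} j (D : Vec (Fin n) j → Bool) → cnt j D ≤ n ^ j
cnt≤n^j zero    D = 𝟙≤1 (D [])
cnt≤n^j (suc j) D = ∑-≤ (λ x → cnt≤n^j j (λ v → D (x ∷ v)))

-- The average of `f` is at least B/K. Values below B/(2K) account for at most half of the sum, and
-- every other value is at most `B`, so at least n/(2K) vertices reach B/(2K).
markov : ∀ {n} B K (f : Fin n → ℕ) → 0 < B → (∀ u → f u ≤ B) → n * B ≤ K * ∑ f →
  n ≤ 2 * K * ∣ (λ u → B ≤ᵇ 2 * K * f u) ∣ᵇ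
markov {n} B K f 0<B f≤B dense = *-cancelʳ-≤ n (2 * K * #W) B {{>-nonZero 0<B}}
  (+-cancelˡ-≤ (n * B) _ _ (begin
    n * B + n * B                       ≤⟨ +-mono-≤ dense dense ⟩
    K * ∑ f + K * ∑ f                   ≡⟨ double K (∑ f) ⟩
    2 * K * ∑ f                         ≡⟨ sumOf-*ˡ (2 * K) f (allFin n) ⟨
    ∑ (λ u → 2 * K * f u)               ≤⟨ ∑-mono pointwise ⟩
    ∑ (λ u → B + 2 * K * B * 𝟙 (W u))   ≡⟨ sumOf-+ (λ _ → B) (λ u → 2 * K * B * 𝟙 (W u)) (allFin n) ⟩
    ∑ {n} (λ _ → B) + ∑ (λ u → 2 * K * B * 𝟙 (W u))
      ≡⟨ cong₂ _+_ (∑-const n B) (sumOf-*ˡ (2 * K * B) (𝟙 ∘ W) (allFin n)) ⟩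
    n * B + 2 * K * B * #W               ≡⟨ cong (n * B +_) (swap (2 * K) B #W) ⟩
    n * B + 2 * K * #W * B               ∎))
  where
  open ≤-Reasoning
  W : Fin n → Bool
  W u = B ≤ᵇ 2 * K * f u
  #W = ∣ W ∣ᵇ
  double : ∀ a b → a * b + a * b ≡ 2 * a * b
  double = solve-∀
  swap : ∀ a b c → a * b * c ≡ a * c * b
  swap = solve-∀
  pointwise : ∀ u → 2 * K * f u ≤ B + 2 * K * B * 𝟙 (W u)
  pointwise u with W u in eq
  ... | true  = ≤-trans (*-monoʳ-≤ (2 * K) (f≤B u))
                  (≤-trans (≤-reflexive (sym (*-identityʳ (2 * K * B)))) (m≤n+m _ B))
  ... | false = ≤-trans (<⇒≤ (≰⇒> (λ B≤ → subst T eq (≤⇒≤ᵇ B≤)))) (m≤m+n B _)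

-- Families of containers

length-concatMap-≤ : ∀ (f : A → List B) {m} xs → (∀ x → length (f x) ≤ m) →
  length (concatMap f xs) ≤ length xs * m
length-concatMap-≤ f []       h = z≤n
length-concatMap-≤ f (x ∷ xs) h = ≤-trans (≤-reflexive (length-++ (f x)))
  (+-mono-≤ (h x) (length-concatMap-≤ f xs h))

_◂_ : ∀ {k} → Y → (Fin k → Y) → Fin (suc k) → Y
(c ◂ f) zero    = c
(c ◂ f) (suc i) = f i

choices : ∀ {k} → (Fin k → List Y) → List (Fin k → Y)
choices {k = zero}  ls = (λ ()) ∷ []
choices {k = suc k} ls = concatMap (λ c → map (c ◂_) (choices (ls ∘ suc))) (ls zero)

length-choices : ∀ {k} (ls : Fin k → List Y) {m} → (∀ i → length (ls i) ≤ m) →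
  length (choices ls) ≤ m ^ k
length-choices {k = zero}  ls h = ≤-refl
length-choices {k = suc k} ls {m} h = ≤-trans
  (length-concatMap-≤ (λ c → map (c ◂_) (choices (ls ∘ suc))) (ls zero)
    (λ c → ≤-trans (≤-reflexive (length-map (c ◂_) (choices (ls ∘ suc)))) (length-choices (ls ∘ suc) (h ∘ suc))))
  (*-monoˡ-≤ (m ^ k) (h zero))

-- The conclusion is pointwise in `i`, so no two functions ever have to be proved equal.
choices⁺ : ∀ {k} {P : Fin k → Y → Set} (ls : Fin k → List Y) →
  (∀ i → Any (P i) (ls i)) → Any (λ f → ∀ i → P i (f i)) (choices ls)
choices⁺ {k = zero}  ls h = here (λ ())
choices⁺ {k = suc k} {P} ls h = AnyP.concatMap⁺ (λ c → map (c ◂_) (choices (ls ∘ suc)))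
  (Any.map (λ {c} p → AnyP.map⁺ (Any.map (λ { {f} q zero → p ; {f} q (suc i) → q i }) (choices⁺ (ls ∘ suc) (h ∘ suc))))
    (h zero))

module Covering (n : ℕ) (2≤n : 2 ≤ n) where

  private instance
    n≢0 : NonZero n
    n≢0 = >-nonZero (≤-trans (s≤s z≤n) 2≤n)

  -- Q relates an object to its admissible containers; every object of the class P has one
  -- among the at most n ^ M listed ones.
  record Cov (P : A → Set) (Q : A → Y → Set) (M : ℕ) : Set where
    constructor cov
    field
      list  : List Y
      size  : length list ≤ n ^ M
      cover : ∀ a → P a → Any (Q a) list

  open Cov

  Cov-none : {P : A → Set} {Q : A → Y → Set} {M : ℕ} → (∀ a → ¬ P a) → Cov P Q M
  Cov-none ¬P = cov [] z≤n (λ a p → ⊥-elim (¬P a p))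

  Cov-one : {P : A → Set} {Q : A → Y → Set} {M : ℕ} (c : Y) → (∀ a → P a → Q a c) → Cov P Q M
  Cov-one {M = M} c h = cov (c ∷ []) (m^n>0 n M) (λ a p → here (h a p))

  Cov-mono : {P P′ : A → Set} {Q Q′ : A → Y → Set} {M M′ : ℕ} →
    (∀ a → P′ a → P a) → (∀ a c → P′ a → Q a c → Q′ a c) → M ≤ M′ → Cov P Q M → Cov P′ Q′ M′
  Cov-mono P⊆ Q⊆ M≤ 𝒞 = cov (list 𝒞) (≤-trans (size 𝒞) (^-monoʳ-≤ n M≤))
    (λ a p → Any.map (λ {c} → Q⊆ a c p) (cover 𝒞 a (P⊆ a p)))

  Cov-≤ : {P : A → Set} {Q : A → Y → Set} {M M′ : ℕ} → M ≤ M′ → Cov P Q M → Cov P Q M′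
  Cov-≤ = Cov-mono (λ _ p → p) (λ _ _ _ q → q)

  Cov-via : (g : B → A) {P : A → Set} {Q : A → Y → Set} {M : ℕ} →
    Cov P Q M → Cov (P ∘ g) (Q ∘ g) M
  Cov-via g 𝒞 = cov (list 𝒞) (size 𝒞) (λ b → cover 𝒞 (g b))

  -- A choice in two stages: the outcome `b` of the first narrows the class that the second has to
  -- cover. Sizes multiply, so exponents add.
  Cov-bind : {P : A → Set} {R : A → B → Set} {Q : A → Y → Set} {M M′ : ℕ} →
    Cov P R M → (∀ b → Cov (λ a → P a × R a b) Q M′) → Cov P Q (M + M′)
  Cov-bind {M = M} {M′} 𝒞 𝒟 = cov (concatMap (list ∘ 𝒟) (list 𝒞))
    (≤-trans (length-concatMap-≤ (list ∘ 𝒟) (list 𝒞) (size ∘ 𝒟))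
      (≤-trans (*-monoˡ-≤ (n ^ M′) (size 𝒞)) (≤-reflexive (sym (^-distribˡ-+-* n M M′)))))
    (λ a p → AnyP.concatMap⁺ (list ∘ 𝒟) (Any.map (λ {b} r → cover (𝒟 b) a (p , r)) (cover 𝒞 a p)))

  -- A condition not depending on the covered object may be assumed while building the cover,
  -- because the class is empty when it fails.
  Cov-given : {X : Set} → Dec X → {P : A → Set} {Q : A → Y → Set} {M : ℕ} →
    (X → Cov P Q M) → Cov (λ a → X × P a) Q M
  Cov-given (yes x) 𝒞 = Cov-mono (λ _ → proj₂) (λ _ _ _ q → q) ≤-refl (𝒞 x)
  Cov-given (no ¬x) 𝒞 = Cov-none (λ a xp → ¬x (proj₁ xp))

  Cov-∃ : {P : A → Fin n → Set} {Q : A → Y → Set} {M : ℕ} →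
    (∀ u → Cov (λ a → P a u) Q M) → Cov (λ a → ∃[ u ] P a u) Q (1 + M)
  Cov-∃ {M = M} 𝒞 = cov (concatMap (list ∘ 𝒞) (allFin n))
    (≤-trans (length-concatMap-≤ (list ∘ 𝒞) (allFin n) (size ∘ 𝒞))
      (≤-reflexive (cong (_* n ^ M) (length-tabulate {n = n} _))))
    (λ a (u , p) → AnyP.concatMap⁺ (list ∘ 𝒞) (lose (∈-allFin u) (cover (𝒞 u) a p)))

  -- A binary choice doubles the list, and 2 ≤ n turns this into one unit of the exponent.
  Cov-⊎ : {P P₁ P₂ : A → Set} {Q : A → Y → Set} {M : ℕ} → (∀ a → P a → P₁ a ⊎ P₂ a) →
    Cov P₁ Q M → Cov P₂ Q M → Cov P Q (1 + M)
  Cov-⊎ {P = P} {P₁} {P₂} {Q = Q} {M = M} split 𝒞 𝒟 = cov (list 𝒞 ++ list 𝒟)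
    (begin
      length (list 𝒞 ++ list 𝒟)          ≡⟨ length-++ (list 𝒞) ⟩
      length (list 𝒞) + length (list 𝒟)  ≤⟨ +-mono-≤ (size 𝒞) (≤-trans (size 𝒟) (m≤m+n _ 0)) ⟩
      2 * n ^ M                          ≤⟨ *-monoˡ-≤ (n ^ M) 2≤n ⟩
      n ^ (1 + M)                        ∎)
    (λ a p → case a (split a p))
    where
    open ≤-Reasoning
    case : ∀ a → P₁ a ⊎ P₂ a → Any (Q a) (list 𝒞 ++ list 𝒟)
    case a (inj₁ p) = AnyP.++⁺ˡ (cover 𝒞 a p)
    case a (inj₂ p) = AnyP.++⁺ʳ (list 𝒞) (cover 𝒟 a p)

  Cov-∀ : ∀ {k} {P : Fin k → A → Set} {Q : Fin k → A → Y → Set} {M : ℕ} →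
    (∀ i → Cov (P i) (Q i) M) → Cov (λ a → ∀ i → P i a) (λ a f → ∀ i → Q i a (f i)) (k * M)
  Cov-∀ {k = k} {M = M} 𝒞 = cov (choices (list ∘ 𝒞))
    (≤-trans (length-choices (list ∘ 𝒞) (size ∘ 𝒞))
      (≤-reflexive (trans (^-*-assoc n M k) (cong (n ^_) (*-comm M k)))))
    (λ a p → choices⁺ (list ∘ 𝒞) (λ i → cover (𝒞 i) a (p i)))

  -- All `n` bits of the set `g a` are guessed, each for one unit of the exponent.
  Cov-reveal : (g : A → Fin n → Bool) {P : A → Set} {Q : A → Y → Set} {M : ℕ} →
    (∀ N → Cov (λ a → P a × g a ≗ N) Q M) → Cov P Q (n + M)
  Cov-reveal {A = A} g {P} {M = M} 𝒞 = Cov-≤ (≤-reflexive (cong (_+ M) (*-identityʳ n)))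
    (Cov-bind (Cov-mono (λ a p _ → p) (λ _ _ _ q → q) ≤-refl (Cov-∀ bit)) 𝒞)
    where
    bit : (x : Fin n) → Cov P (λ a b → g a x ≡ b) 1
    bit x = cov (true ∷ false ∷ []) (≤-trans 2≤n (≤-reflexive (sym (*-identityʳ n))))
      (λ a _ → found (g a x))
      where
      found : ∀ b → Any (b ≡_) (true ∷ false ∷ [])
      found true  = here refl
      found false = there (here refl)

-- Containers for graphs without cliques on a dense set of tuples

cnt-cong : ∀ {n} j {D E : Vec (Fin n) j → Bool} → (∀ v → D v ≡ E v) → cnt j D ≡ cnt j E
cnt-cong zero    h = cong 𝟙 (h [])
cnt-cong {n} (suc j) h = sumOf-cong (λ x → cnt-cong j (λ v → h (x ∷ v))) (allFin n)

term≤∑ : ∀ {n} (f : Fin n → ℕ) u → f u ≤ ∑ f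
term≤∑ {n} f u = ≤-trans (m≤m+n (f u) 0)
  (sumOf-unique-⊆ f ([] ∷ []) (allFin n) (λ {x} _ → ∈-allFin x))

sumOf-𝟙≟≤1 : ∀ {n} (u : Fin n) {xs} → Unique xs → sumOf (λ x → 𝟙 (does (x ≟ᶠ u))) xs ≤ 1
sumOf-𝟙≟≤1 u [] = z≤n
sumOf-𝟙≟≤1 u {x ∷ xs} (x∉ ∷ uniq) with x ≟ᶠ u
... | no  _    = sumOf-𝟙≟≤1 u uniq
... | yes refl = s≤s (≤-reflexive (none x∉))
  where
  none : ∀ {ys} → All (u ≢_) ys → sumOf (λ y → 𝟙 (does (y ≟ᶠ u))) ys ≡ 0
  none [] = refl
  none {y ∷ ys} (u≢y ∷ rest) with y ≟ᶠ u
  ... | yes y≡u = ⊥-elim (u≢y (sym y≡u))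
  ... | no  _   = none rest

inside : ∀ {n j} → (Fin n → Bool) → Vec (Fin n) j → Bool
inside N []      = true
inside N (x ∷ v) = N x ∧ inside N v

inside-cong : ∀ {n j} {N N′ : Fin n → Bool} → N ≗ N′ → (v : Vec (Fin n) j) → inside N v ≡ inside N′ v
inside-cong h []      = refl
inside-cong h (x ∷ v) = cong₂ _∧_ (h x) (inside-cong h v)

inside⇒All : ∀ {n j} {N : Fin n → Bool} (v : Vec (Fin n) j) → T (inside N v) → VecAll.All (T ∘ N) v
inside⇒All []      _ = []
inside⇒All {N = N} (x ∷ v) h with N x in eq
... | true = subst T (sym eq) tt ∷ inside⇒All v h

_⟂_ : ∀ {n} → (Fin n → Bool) → (Fin n → Bool) → Set
N ⟂ R = ∀ x → T (R x) → ¬ T (N x)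

Graph : ℕ → Set
Graph n = Fin n → Fin n → Bool

-- Pairs are tested in the order of the tuple, so a clique on `u ∷ v` is exactly a clique on `v`
-- lying inside the row `I u`.
NoClique : ∀ {n j} → (Vec (Fin n) j → Bool) → Graph n → Set
NoClique D I = ∀ v → T (D v) → ¬ VecPairs.AllPairs (λ x y → T (I x y)) v

-- The summands pay for the rounds of `grow`, for the recursion on a dense `H`, and for one use of
-- `Cov-sparse` per row.
β : ℕ → ℕ
β zero    = 0
β (suc j) = 4 + β j + (2 * j + 2)

-- The two inequalities on `t * e` make `e` the integer part of n/t. The number 1/L bounds all
-- densities in the recursion from below, and 2L ≤ t keeps `e` at most n/(2L).
module Containers (n t e L : ℕ) (2≤n : 2 ≤ n) (t*e≤n : t * e ≤ n) (n<t*[1+e] : n < t * suc e)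
  (2L≤t : 2 * L ≤ t) where

  open Covering n 2≤n

  private
    0<n : 0 < n
    0<n = ≤-trans (s≤s z≤n) 2≤n
    instance
      n≢0 : NonZero n
      n≢0 = >-nonZero 0<n

  -- List the elements of `N` in `W` one by one and delete them from `W`. Each costs two units, one
  -- for the vertex and one for deciding whether to continue; what is left of `W` is `R`.
  Cov-almost-disjoint : ∀ f (W : Fin n → Bool) →
    Cov (λ N → ∣ (λ x → N x ∧ W x) ∣ᵇ ≤ f) (λ N R → N ⟂ R × ∣ W ∣ᵇ ≤ ∣ R ∣ᵇ + f) (2 * f)
  Cov-almost-disjoint zero W = Cov-one W (λ N small → disjoint N small , ≤-reflexive (sym (+-identityʳ _)))
    where
    disjoint : ∀ N → ∣ (λ x → N x ∧ W x) ∣ᵇ ≤ 0 → N ⟂ W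
    disjoint N small x Wx Nx with N x | W x | ≤-trans (term≤∑ (λ x → 𝟙 (N x ∧ W x)) x) small
    ... | true | true | ()
  Cov-almost-disjoint (suc f) W = Cov-≤ (≤-reflexive (cost f)) (Cov-⊎ split
    (Cov-∃ {P = λ N u → T (W u) × ∣ (λ x → N x ∧ (W ∖ u) x) ∣ᵇ ≤ f} λ u → Cov-given (T? (W u)) λ _ →
      Cov-mono (λ _ p → p) (λ { N R _ (N⟂R , h) → N⟂R , enlarge u h }) ≤-refl (Cov-almost-disjoint f (W ∖ u)))
    (Cov-one W λ N N⟂W → N⟂W , m≤m+n _ _))
    where
    open ≤-Reasoning
    cost : ∀ f → 1 + (1 + 2 * f) ≡ 2 * suc f
    cost = solve-∀
    _∖_ : (Fin n → Bool) → Fin n → Fin n → Bool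
    (W ∖ u) x = W x ∧ not (does (x ≟ᶠ u))
    δ : Fin n → Fin n → ℕ
    δ u x = 𝟙 (does (x ≟ᶠ u))
    enlarge : ∀ u {r} → ∣ W ∖ u ∣ᵇ ≤ r + f → ∣ W ∣ᵇ ≤ r + suc f
    enlarge u {r} h = begin
      ∣ W ∣ᵇ                       ≤⟨ ∑-mono pointwise ⟩
      ∑ (λ x → 𝟙 ((W ∖ u) x) + δ u x) ≡⟨ sumOf-+ (𝟙 ∘ (W ∖ u)) (δ u) (allFin n) ⟩
      ∣ W ∖ u ∣ᵇ + ∑ (δ u)          ≤⟨ +-mono-≤ h (sumOf-𝟙≟≤1 u (UniqueP.allFin⁺ n)) ⟩
      r + f + 1                    ≡⟨ trans (+-assoc r f 1) (cong (r +_) (+-comm f 1)) ⟩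
      r + suc f                    ∎
      where
      pointwise : ∀ x → 𝟙 (W x) ≤ 𝟙 ((W ∖ u) x) + δ u x
      pointwise x with W x | does (x ≟ᶠ u)
      ... | true  | true  = ≤-refl
      ... | true  | false = ≤-refl
      ... | false | _     = z≤n
    shrink : ∀ N u → T (N u ∧ W u) → ∣ (λ x → N x ∧ W x) ∣ᵇ ≤ suc f → ∣ (λ x → N x ∧ (W ∖ u) x) ∣ᵇ ≤ f
    shrink N u hit small = +-cancelʳ-≤ 1 _ _ (begin
      ∣ (λ x → N x ∧ (W ∖ u) x) ∣ᵇ + 1          ≤⟨ +-monoʳ-≤ _ (≤-trans 1≤δ (term≤∑ (δ u) u)) ⟩
      ∣ (λ x → N x ∧ (W ∖ u) x) ∣ᵇ + ∑ (δ u)    ≡⟨ sumOf-+ (λ x → 𝟙 (N x ∧ (W ∖ u) x)) (δ u) (allFin n) ⟨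
      ∑ (λ x → 𝟙 (N x ∧ (W ∖ u) x) + δ u x)    ≤⟨ ∑-mono pointwise ⟩
      ∣ (λ x → N x ∧ W x) ∣ᵇ                    ≤⟨ small ⟩
      suc f                                    ≡⟨ +-comm 1 f ⟩
      f + 1                                    ∎)
      where
      1≤δ : 1 ≤ δ u u
      1≤δ with u ≟ᶠ u
      ... | yes _  = ≤-refl
      ... | no u≢u = ⊥-elim (u≢u refl)
      removed : ∀ a b → T (a ∧ b) → 𝟙 (a ∧ (b ∧ false)) + 1 ≤ 𝟙 (a ∧ b)
      removed true true _ = ≤-refl
      kept : ∀ a b → 𝟙 (a ∧ (b ∧ true)) + 0 ≤ 𝟙 (a ∧ b)
      kept true  true  = ≤-refl
      kept true  false = ≤-refl
      kept false _     = ≤-refl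
      pointwise : ∀ x → 𝟙 (N x ∧ (W ∖ u) x) + δ u x ≤ 𝟙 (N x ∧ W x)
      pointwise x with x ≟ᶠ u
      ... | yes refl = removed (N u) (W u) hit
      ... | no _     = kept (N x) (W x)
    split : ∀ N → ∣ (λ x → N x ∧ W x) ∣ᵇ ≤ suc f →
      (∃[ u ] (T (W u) × ∣ (λ x → N x ∧ (W ∖ u) x) ∣ᵇ ≤ f)) ⊎ N ⟂ W
    split N small with any? (λ u → T? (N u ∧ W u))
    ... | yes (u , hit) = inj₁ (u , proj₂ (Equivalence.to T-∧ hit) , shrink N u hit small)
    ... | no  none      = inj₂ (λ x Wx Nx → none (x , Equivalence.from T-∧ (Nx , Wx)))

  Sparse : ∀ j → (Vec (Fin n) j → Bool) → (Fin n → Bool) → Set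
  Sparse j D N = t ^ j * cnt j (λ v → D v ∧ inside N v) < n ^ j

  -- The set W of vertices with dense link is linear.  Either some u in N ∩ W has a link on which N is
  -- still sparse, and one recurses into it, or averaging gives |N ∩ W| ≤ n/t.  Densities halve at
  -- each level, so 2 ^ j * K does not change.
  Cov-sparse : ∀ j K (D : Vec (Fin n) j → Bool) → n ^ j ≤ K * cnt j D → 2 ^ j * K ≤ L →
    Cov (Sparse j D) (λ N R → N ⟂ R × n ≤ 2 * L * ∣ R ∣ᵇ) (2 * j + 2 * e)
  Cov-sparse zero K D dense _ = Cov-none absurd
    where
    -- On the empty tuple, sparseness makes `D []` false while density makes it true.
    absurd : ∀ N → ¬ Sparse zero D N
    absurd N sparse with D []
    ... | true  = <-irrefl refl sparse
    ... | false = <⇒≱ dense (≤-reflexive (*-zeroʳ K))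
  Cov-sparse (suc j) K D dense K≤L = Cov-≤ (≤-reflexive (cost j e)) (Cov-⊎ split
    (Cov-∃ λ u → Cov-given (T? (W u)) λ Wu → Cov-sparse j (2 * K) (link u) (≤ᵇ⇒≤ _ _ Wu)
      (≤-trans (≤-reflexive (shift (2 ^ j) K)) K≤L))
    (Cov-mono (λ _ p → p) (λ { N R _ (N⟂R , h) → N⟂R , large h }) (≤-trans (m≤n+m _ (2 * j)) (n≤1+n _))
      (Cov-almost-disjoint e W)))
    where
    open ≤-Reasoning
    link : Fin n → Vec (Fin n) j → Bool
    link u v = D (u ∷ v)
    W : Fin n → Bool
    W u = n ^ j ≤ᵇ 2 * K * cnt j (link u)
    cost : ∀ j e → 1 + (1 + (2 * j + 2 * e)) ≡ 2 * suc j + 2 * e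
    cost = solve-∀
    shift : ∀ a K → a * (2 * K) ≡ 2 * a * K
    shift = solve-∀
    n≤2KW : n ≤ 2 * K * ∣ W ∣ᵇ
    n≤2KW = markov (n ^ j) K (λ u → cnt j (link u)) (m^n>0 n j) (λ u → cnt≤n^j j (link u)) dense
    2K≤L : 2 * K ≤ L
    2K≤L = begin
      2 * K           ≤⟨ m≤n*m (2 * K) (2 ^ j) {{>-nonZero (m^n>0 2 j)}} ⟩
      2 ^ j * (2 * K) ≡⟨ shift (2 ^ j) K ⟩
      2 ^ suc j * K   ≤⟨ K≤L ⟩
      L               ∎
    -- From n ≤ L|W| follows 2n ≤ 2L(r + e), and 2Le ≤ te ≤ n absorbs the loss of the `e` listed
    -- vertices.
    large : ∀ {r} → ∣ W ∣ᵇ ≤ r + e → n ≤ 2 * L * r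
    large {r} h = +-cancelʳ-≤ n n _ (begin
      n + n                             ≤⟨ +-mono-≤ n≤LW n≤LW ⟩
      L * ∣ W ∣ᵇ + L * ∣ W ∣ᵇ            ≡⟨ double L ∣ W ∣ᵇ ⟩
      2 * L * ∣ W ∣ᵇ                     ≤⟨ *-monoʳ-≤ (2 * L) h ⟩
      2 * L * (r + e)                   ≡⟨ *-distribˡ-+ (2 * L) r e ⟩
      2 * L * r + 2 * L * e             ≤⟨ +-monoʳ-≤ _ (≤-trans (*-monoˡ-≤ e 2L≤t) t*e≤n) ⟩
      2 * L * r + n                     ∎)
      where
      n≤LW : n ≤ L * ∣ W ∣ᵇ
      n≤LW = ≤-trans n≤2KW (*-monoˡ-≤ ∣ W ∣ᵇ 2K≤L)
      double : ∀ a b → a * b + a * b ≡ 2 * a * b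
      double = solve-∀
    -- Each vertex of N ∩ W now starts at least (n/t)^j tuples inside `N`, and there are fewer than
    -- (n/t)^(j+1) in all.
    few : ∀ N → Sparse (suc j) D N → (∀ u → T (N u ∧ W u) → ¬ Sparse j (link u) N) →
      ∣ (λ x → N x ∧ W x) ∣ᵇ ≤ e
    few N sparse none = ≤-pred (*-cancelˡ-< t _ _ (<-trans (*-cancelʳ-< (n ^ j) (t * #N∩W) n (begin-strict
      t * #N∩W * n ^ j                              ≡⟨ *-assoc t #N∩W (n ^ j) ⟩
      t * (#N∩W * n ^ j)                     
        ≡⟨ cong (t *_) (trans (*-comm #N∩W (n ^ j)) (sym (sumOf-*ˡ (n ^ j) _ (allFin n)))) ⟩
      t * ∑ (λ u → n ^ j * 𝟙 (N u ∧ W u))        ≤⟨ *-monoʳ-≤ t (∑-mono pointwise) ⟩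
      t * ∑ (λ u → t ^ j * cnt j (λ v → link u v ∧ (N u ∧ inside N v))) ≡⟨ cong (t *_) (sumOf-*ˡ (t ^ j) _ (allFin n)) ⟩
      t * (t ^ j * cnt (suc j) (λ v → D v ∧ inside N v))  ≡⟨ *-assoc t (t ^ j) _ ⟨
      t ^ suc j * cnt (suc j) (λ v → D v ∧ inside N v)    <⟨ sparse ⟩
      n ^ suc j                                  ∎)) n<t*[1+e]))
      where
      #N∩W = ∣ (λ x → N x ∧ W x) ∣ᵇ
      pointwise : ∀ u → n ^ j * 𝟙 (N u ∧ W u) ≤ t ^ j * cnt j (λ v → link u v ∧ (N u ∧ inside N v))
      pointwise u with N u | W u | none u
      ... | true  | true  | ¬sparse = ≤-trans (≤-reflexive (*-identityʳ (n ^ j))) (≮⇒≥ (¬sparse tt))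
      ... | true  | false | _       = ≤-trans (≤-reflexive (*-zeroʳ (n ^ j))) z≤n
      ... | false | _     | _       = ≤-trans (≤-reflexive (*-zeroʳ (n ^ j))) z≤n
    split : ∀ N → Sparse (suc j) D N →
      (∃[ u ] (T (W u) × Sparse j (link u) N)) ⊎ ∣ (λ x → N x ∧ W x) ∣ᵇ ≤ e
    split N sparse with any? (λ u → T? (N u ∧ W u) ×-dec (t ^ j * cnt j (λ v → link u v ∧ inside N v) <? n ^ j))
    ... | yes (u , hit , sp) = inj₁ (u , proj₂ (Equivalence.to T-∧ hit) , sp)
    ... | no  none           = inj₂ (few N sparse (λ u hit sp → none (u , hit , sp)))

  Removal : Graph n → Graph n → Set
  Removal I R = (∀ x → I x ⟂ R x) × n * n ≤ 2 * L * (2 * L) * ∑ (λ x → ∣ R x ∣ᵇ)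

  -- Passing to `H`, or to the links with `H` removed, replaces `K` by at most 4K while `j` drops;
  -- the leading factor 2 in the bound by `L` pays for this. The bounds t^i ≤ e keep the rounds of
  -- `grow` within O(ne).
  Cov-NoClique : ∀ j K (D : Vec (Fin n) j → Bool) → n ^ j ≤ K * cnt j D → 2 * (2 ^ j * K) ≤ L →
    (∀ i → i < j → t ^ i ≤ e) → Cov (NoClique D) Removal (β j * (n * e))
  Cov-NoClique zero K D dense _ _ = Cov-none absurd
    where
    absurd : ∀ I → ¬ NoClique D I
    absurd I noClique with D [] in eq
    ... | true  = noClique [] (subst T (sym eq) tt) []
    ... | false = <⇒≱ dense (≤-reflexive (*-zeroʳ K))
  Cov-NoClique (suc j) K D dense K≤L t^i≤e = Cov-mono (λ I p → p , λ _ ()) (λ _ _ _ q → q) cost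
    -- The empty `H` trivially carries no clique.
    (grow (suc (t ^ j)) (λ _ → false) initially)
    where
    open ≤-Reasoning
    shift : ∀ a K → 2 * (a * (2 * K)) ≡ 2 * (2 * a * K)
    shift = solve-∀
    shift′ : ∀ a K → a * (2 * (2 * K)) ≡ 2 * (2 * a * K)
    shift′ = solve-∀
    link : Fin n → Vec (Fin n) j → Bool
    link u v = D (u ∷ v)
    deeper = β j * (n * e)
    rows = n * (2 * j + 2 * e)

    module _ (H : Vec (Fin n) j → Bool) where
      fresh : Fin n → Vec (Fin n) j → Bool
      fresh u v = link u v ∧ not (H v)

      -- Removing `H` from every link costs fewer than n^(j+1)/(2K) tuples, at most half of `D`. By
      -- averaging, the set `V` of vertices whose fresh link stays dense is linear, and `Cov-sparse`
      -- yields a linear row of `R` at each of them.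
      Cov-all-sparse : 2 * K * cnt j H < n ^ j →
        Cov (λ I → ∀ u → Sparse j (fresh u) (I u)) Removal rows
      Cov-all-sparse thin = Cov-mono (λ _ p → p)
        (λ I R _ h → (λ x → proj₁ (h x)) , count R (λ x → proj₂ (h x)))
        ≤-refl
        (Cov-∀ {Q = λ u I R → I u ⟂ R × (T (V u) → n ≤ 2 * L * ∣ R ∣ᵇ)} each)
        where
        V : Fin n → Bool
        V u = n ^ j ≤ᵇ 2 * (2 * K) * cnt j (fresh u)
        each : ∀ u → Cov (λ I → Sparse j (fresh u) (I u)) (λ I R → I u ⟂ R × (T (V u) → n ≤ 2 * L * ∣ R ∣ᵇ)) (2 * j + 2 * e)
        each u with V u in eq
        ... | true  = Cov-via (λ I → I u) (Cov-mono (λ _ p → p) (λ { N R _ (N⟂R , h) → N⟂R , λ _ → h }) ≤-refl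
                        (Cov-sparse j (2 * (2 * K)) (fresh u) (≤ᵇ⇒≤ _ _ (subst T (sym eq) tt))
                          (≤-trans (≤-reflexive (shift′ (2 ^ j) K)) K≤L)))
        -- Vertices outside `V` get an empty row, at no cost in the count of `R`.
        ... | false = Cov-one (λ _ → false) (λ _ _ → (λ _ ()) , λ ())
        freshDense : n * n ^ j ≤ 2 * K * ∑ (λ u → cnt j (fresh u))
        freshDense = +-cancelʳ-≤ (n * n ^ j) _ _ (begin
          n * n ^ j + n * n ^ j                 ≤⟨ +-mono-≤ dense dense ⟩
          K * cnt (suc j) D + K * cnt (suc j) D ≡⟨ double K (cnt (suc j) D) ⟩
          2 * K * cnt (suc j) D                 ≤⟨ *-monoʳ-≤ (2 * K) (∑-mono λ u → cnt-mono-+ j {link u} {fresh u} {H} (pointwise u)) ⟩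
          2 * K * ∑ (λ u → cnt j (fresh u) + cnt j H)
            ≡⟨ cong (2 * K *_) (trans (sumOf-+ (λ u → cnt j (fresh u)) (λ _ → cnt j H) (allFin n))
                 (cong (∑ (λ u → cnt j (fresh u)) +_) (∑-const n (cnt j H)))) ⟩
          2 * K * (∑ (λ u → cnt j (fresh u)) + n * cnt j H) ≡⟨ distr (2 * K) _ n (cnt j H) ⟩
          2 * K * ∑ (λ u → cnt j (fresh u)) + n * (2 * K * cnt j H) ≤⟨ +-monoʳ-≤ _ (*-monoʳ-≤ n (<⇒≤ thin)) ⟩
          2 * K * ∑ (λ u → cnt j (fresh u)) + n * n ^ j ∎)
          where
          double : ∀ a b → a * b + a * b ≡ 2 * a * b
          double = solve-∀
          distr : ∀ a b c d → a * (b + c * d) ≡ a * b + c * (a * d)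
          distr = solve-∀
          pointwise : ∀ u v → 𝟙 (link u v) ≤ 𝟙 (fresh u v) + 𝟙 (H v)
          pointwise u v with link u v | H v
          ... | true  | true  = ≤-refl
          ... | true  | false = ≤-refl
          ... | false | _     = z≤n
        n≤LV : n ≤ L * ∣ V ∣ᵇ
        n≤LV = ≤-trans (markov (n ^ j) (2 * K) (λ u → cnt j (fresh u)) (m^n>0 n j) (λ u → cnt≤n^j j (fresh u)) freshDense)
          (*-monoˡ-≤ ∣ V ∣ᵇ (begin
            2 * (2 * K)             ≤⟨ m≤n*m (2 * (2 * K)) (2 ^ j) {{>-nonZero (m^n>0 2 j)}} ⟩
            2 ^ j * (2 * (2 * K))   ≡⟨ shift′ (2 ^ j) K ⟩
            2 * (2 ^ suc j * K)     ≤⟨ K≤L ⟩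
            L                       ∎))
        count : ∀ R → (∀ u → T (V u) → n ≤ 2 * L * ∣ R u ∣ᵇ) → n * n ≤ 2 * L * (2 * L) * ∑ (λ u → ∣ R u ∣ᵇ)
        count R h = begin
          n * n                                ≤⟨ *-monoˡ-≤ n (≤-trans n≤LV (*-monoˡ-≤ ∣ V ∣ᵇ (m≤m+n L (1 * L)))) ⟩
          2 * L * ∣ V ∣ᵇ * n                    ≡⟨ *-assoc (2 * L) ∣ V ∣ᵇ n ⟩
          2 * L * (∣ V ∣ᵇ * n)
            ≡⟨ cong (2 * L *_) (trans (*-comm ∣ V ∣ᵇ n) (sym (sumOf-*ˡ n (𝟙 ∘ V) (allFin n)))) ⟩
          2 * L * ∑ (λ u → n * 𝟙 (V u))        ≤⟨ *-monoʳ-≤ (2 * L) (∑-mono pointwise) ⟩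
          2 * L * ∑ (λ u → 2 * L * ∣ R u ∣ᵇ)    ≡⟨ cong (2 * L *_) (sumOf-*ˡ (2 * L) (λ u → ∣ R u ∣ᵇ) (allFin n)) ⟩
          2 * L * (2 * L * ∑ (λ u → ∣ R u ∣ᵇ))  ≡⟨ *-assoc (2 * L) (2 * L) _ ⟨
          2 * L * (2 * L) * ∑ (λ u → ∣ R u ∣ᵇ)  ∎
          where
          pointwise : ∀ u → n * 𝟙 (V u) ≤ 2 * L * ∣ R u ∣ᵇ
          pointwise u with V u | h u
          ... | true  | large = ≤-trans (≤-reflexive (*-identityʳ n)) (large tt)
          ... | false | _     = ≤-trans (≤-reflexive (*-zeroʳ n)) z≤n

    gain : (Vec (Fin n) j → Bool) → Fin n → (Fin n → Bool) → ℕ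
    gain H u N = cnt j (λ v → fresh H u v ∧ inside N v)

    extend : (Vec (Fin n) j → Bool) → Fin n → (Fin n → Bool) → Vec (Fin n) j → Bool
    extend H u N v = H v ∨ (link u v ∧ inside N v)

    -- Fresh tuples avoid `H`, so the two counts add. This is why `gain` is measured on `fresh`
    -- rather than on `link`.
    cnt-extend : ∀ H u N → cnt j H + gain H u N ≤ cnt j (extend H u N)
    cnt-extend H u N = cnt-+-mono j {extend H u N} {H} pointwise
      where
      pointwise : ∀ v → 𝟙 (H v) + 𝟙 (fresh H u v ∧ inside N v) ≤ 𝟙 (extend H u N v)
      pointwise v with H v | link u v | inside N v
      ... | true  | true  | _     = ≤-refl
      ... | true  | false | _     = ≤-refl
      ... | false | true  | true  = ≤-refl
      ... | false | true  | false = ≤-refl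
      ... | false | false | _     = ≤-refl

    -- A clique on a new tuple `v` lies in the neighbourhood of `u`, so `u ∷ v` would be a clique on
    -- a tuple of `D`.
    NoClique-extend : ∀ H u N I → I u ≗ N → NoClique D I → NoClique H I → NoClique (extend H u N) I
    NoClique-extend H u N I I≗N noD noH v h pairs with Equivalence.to (T-∨ {H v}) h
    ... | inj₁ Hv  = noH v Hv pairs
    ... | inj₂ Duv with Equivalence.to (T-∧ {link u v}) Duv
    ...   | Duv′ , in-N = noD (u ∷ v) Duv′ (inside⇒All v (subst T (sym (inside-cong I≗N v)) in-N) ∷ pairs)

    -- H has gained n ^ j / t ^ j tuples in each of the t ^ j + 1 - f rounds so far.
    grow : ∀ f H → t ^ j * n ^ j < t ^ j * cnt j H + f * n ^ j →
      Cov (λ I → NoClique D I × NoClique H I) Removal (f * (n + 2) + (deeper + rows))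
    -- With no rounds left the invariant says that `H` has more than n^j tuples.
    grow zero    H inv = ⊥-elim (<⇒≱ inv (≤-trans (≤-reflexive (+-identityʳ _)) (*-monoʳ-≤ (t ^ j) (cnt≤n^j j H))))
    grow (suc f) H inv with n ^ j ≤? 2 * K * cnt j H
    ... | yes thick = Cov-mono (λ _ → proj₂) (λ _ _ _ q → q) (≤-trans (m≤m+n deeper rows) (m≤n+m (deeper + rows) (suc f * (n + 2))))
                        (Cov-NoClique j (2 * K) H thick (≤-trans (≤-reflexive (shift (2 ^ j) K)) K≤L) (λ i i<j → t^i≤e i (m≤n⇒m≤1+n i<j)))
    ... | no ¬thick = Cov-≤ (≤-reflexive (cost′ f n (deeper + rows))) (Cov-⊎ split
      -- A round costs n + 2: the case distinction, the vertex `u`, and its neighbourhood `N`. Once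
      -- `N` is known, richness no longer depends on `I` and can be decided.
      (Cov-∃ λ u → Cov-reveal (λ I → I u) λ N →
        Cov-mono (λ { I (((noD , noH) , rich) , I≗N) →
                      subst (λ c → n ^ j ≤ t ^ j * c) (cnt-cong j (λ v → cong (fresh H u v ∧_) (inside-cong I≗N v))) rich
                      , noD , NoClique-extend H u N I I≗N noD noH })
                 (λ _ _ _ q → q) ≤-refl
          (Cov-given (n ^ j ≤? t ^ j * gain H u N) λ rich → grow f (extend H u N) (step u N rich)))
      (Cov-≤ (≤-trans (m≤n+m rows deeper) (≤-trans (m≤n+m (deeper + rows) (f * (n + 2))) (≤-trans (m≤n+m _ n) (n≤1+n _))))
        (Cov-all-sparse H (≰⇒> ¬thick))))
      where
      cost′ : ∀ f n c → 1 + (1 + (n + (f * (n + 2) + c))) ≡ suc f * (n + 2) + c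
      cost′ = solve-∀
      step : ∀ u N → n ^ j ≤ t ^ j * gain H u N → t ^ j * n ^ j < t ^ j * cnt j (extend H u N) + f * n ^ j
      step u N rich = begin-strict
        t ^ j * n ^ j                                  <⟨ inv ⟩
        t ^ j * cnt j H + (n ^ j + f * n ^ j)          ≡⟨ +-assoc (t ^ j * cnt j H) (n ^ j) (f * n ^ j) ⟨
        t ^ j * cnt j H + n ^ j + f * n ^ j            ≤⟨ +-monoˡ-≤ (f * n ^ j) (+-monoʳ-≤ (t ^ j * cnt j H) rich) ⟩
        t ^ j * cnt j H + t ^ j * gain H u N + f * n ^ j ≡⟨ cong (_+ f * n ^ j) (*-distribˡ-+ (t ^ j) _ _) ⟨
        t ^ j * (cnt j H + gain H u N) + f * n ^ j     ≤⟨ +-monoˡ-≤ (f * n ^ j) (*-monoʳ-≤ (t ^ j) (cnt-extend H u N)) ⟩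
        t ^ j * cnt j (extend H u N) + f * n ^ j       ∎
      split : ∀ I → NoClique D I × NoClique H I →
        (∃[ u ] ((NoClique D I × NoClique H I) × n ^ j ≤ t ^ j * gain H u (I u))) ⊎ (∀ u → Sparse j (fresh H u) (I u))
      split I clean with any? (λ u → n ^ j ≤? t ^ j * gain H u (I u))
      ... | yes (u , rich) = inj₁ (u , clean , rich)
      ... | no  poor       = inj₂ (λ u → ≰⇒> (λ rich → poor (u , rich)))

    -- The one round beyond t^j makes the inequality strict.
    initially : t ^ j * n ^ j < t ^ j * cnt {n} j (λ _ → false) + suc (t ^ j) * n ^ j
    initially = ≤-trans (+-monoˡ-≤ (t ^ j * n ^ j) (m^n>0 n j)) (m≤n+m (n ^ j + t ^ j * n ^ j) (t ^ j * cnt {n} j (λ _ → false)))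

    cost : suc (t ^ j) * (n + 2) + (deeper + rows) ≤ β (suc j) * (n * e)
    cost = begin
      suc (t ^ j) * (n + 2) + (deeper + rows)
        -- Here 1 + t^j ≤ 2e and n + 2 ≤ 2n, whence the 4 in `β`.
        ≤⟨ +-mono-≤ (*-mono-≤ (+-mono-≤ (t^i≤e 0 (s≤s z≤n)) (t^i≤e j ≤-refl)) (+-monoʳ-≤ n 2≤n))
             (+-monoʳ-≤ deeper (*-monoʳ-≤ n (+-monoˡ-≤ (2 * e) 2j≤2je))) ⟩
      (e + e) * (n + n) + (deeper + n * (2 * j * e + 2 * e))
        ≡⟨ collect e n (β j) j ⟩
      β (suc j) * (n * e) ∎
      where
      2j≤2je : 2 * j ≤ 2 * j * e
      2j≤2je = m≤m*n (2 * j) e {{>-nonZero (t^i≤e 0 (s≤s z≤n))}}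
      collect : ∀ e n b j → (e + e) * (n + n) + (b * (n * e) + n * (2 * j * e + 2 * e)) ≡ (4 + b + (2 * j + 2)) * (n * e)
      collect = solve-∀

-- Overweight sets and overweight tuples

image : ∀ {n s} → Vec (Fin n) s → Subset n
image []      = ∅
image (x ∷ v) = ⁅ x ⁆ ∪ image v

lookup∈image : ∀ {n s} (v : Vec (Fin n) s) a → lookup v a ∈ image v
lookup∈image (x ∷ v) zero    = x∈p∪q⁺ (inj₁ (x∈⁅x⁆ x))
lookup∈image (x ∷ v) (suc a) = q⊆p∪q ⁅ x ⁆ (image v) (lookup∈image v a)

∈image⇒lookup : ∀ {n s} (v : Vec (Fin n) s) {y} → y ∈ image v → ∃[ a ] lookup v a ≡ y
∈image⇒lookup []      y∈ = ⊥-elim (∉⊥ y∈)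
∈image⇒lookup (x ∷ v) y∈ with x∈p∪q⁻ ⁅ x ⁆ (image v) y∈
... | inj₁ y∈x = zero , sym (x∈⁅y⁆⇒x≡y x y∈x)
... | inj₂ y∈v with ∈image⇒lookup v y∈v
...   | a , eq = suc a , eq

∣p∪q∣≤∣p∣+∣q∣ : ∀ {n} (p q : Subset n) → ∣ p ∪ q ∣ ≤ ∣ p ∣ + ∣ q ∣
∣p∪q∣≤∣p∣+∣q∣ []          []          = z≤n
∣p∪q∣≤∣p∣+∣q∣ (true ∷ p)  (true ∷ q)  = s≤s (≤-trans (∣p∪q∣≤∣p∣+∣q∣ p q) (+-monoʳ-≤ ∣ p ∣ (n≤1+n ∣ q ∣)))
∣p∪q∣≤∣p∣+∣q∣ (true ∷ p)  (false ∷ q) = s≤s (∣p∪q∣≤∣p∣+∣q∣ p q)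
∣p∪q∣≤∣p∣+∣q∣ (false ∷ p) (true ∷ q)  = ≤-trans (s≤s (∣p∪q∣≤∣p∣+∣q∣ p q)) (≤-reflexive (sym (+-suc ∣ p ∣ ∣ q ∣)))
∣p∪q∣≤∣p∣+∣q∣ (false ∷ p) (false ∷ q) = ∣p∪q∣≤∣p∣+∣q∣ p q

∣image∣ : ∀ {n s} {v : Vec (Fin n) s} → UniqueVec v → ∣ image v ∣ ≡ s
∣image∣ {n} [] = ∣⊥∣≡0 n
∣image∣ {v = x ∷ v} (x∉ ∷ uniq) = ≤-antisym
  (≤-trans (∣p∪q∣≤∣p∣+∣q∣ ⁅ x ⁆ (image v)) (≤-reflexive (cong₂ _+_ (∣⁅x⁆∣≡1 x) (∣image∣ uniq))))
  (≤-trans (≤-reflexive (cong suc (sym (∣image∣ uniq))))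
    (p⊂q⇒∣p∣<∣q∣ (q⊆p∪q ⁅ x ⁆ (image v) , x , x∈p∪q⁺ (inj₁ (x∈⁅x⁆ x)) , x∉image)))
  where
  x∉image : ¬ (x ∈ image v)
  x∉image x∈ with ∈image⇒lookup v x∈
  ... | a , refl = VecAllP.lookup⁺ x∉ a refl

-- Both sets have `s` elements, so the inclusion of the image in `X` cannot be proper.
image≡ : ∀ {n s} {v : Vec (Fin n) s} {X} → UniqueVec v → ∣ X ∣ ≡ s → (∀ a → lookup v a ∈ X) → image v ≡ X
image≡ {v = v} {X} uniq ∣X∣≡s v∈X = ⊆-antisym image⊆X X⊆image
  where
  image⊆X : image v ⊆ X
  image⊆X y∈ with ∈image⇒lookup v y∈
  ... | a , refl = v∈X a
  X⊆image : X ⊆ image v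
  X⊆image {y} y∈ with y ∈? image v
  ... | yes y∈v = y∈v
  ... | no  y∉v = ⊥-elim (<-irrefl (trans (∣image∣ uniq) (sym ∣X∣≡s)) (p⊂q⇒∣p∣<∣q∣ (image⊆X , y , y∈ , y∉v)))

-- Sums over pairs under injections

∑-injective : ∀ {n s} {f : Fin s → Fin n} → Injective _≡_ _≡_ f → (g : Fin n → ℕ) → ∑ (g ∘ f) ≤ ∑ g
∑-injective {n} {s} {f} inj g = ≤-trans (≤-reflexive (sym (sumOf-map g f (allFin s))))
  (sumOf-unique-⊆ g (UniqueP.map⁺ inj (UniqueP.allFin⁺ s)) (allFin n) (λ {x} _ → ∈-allFin x))

∑-cong : ∀ {n} {f g : Fin n → ℕ} → (∀ x → f x ≡ g x) → ∑ f ≡ ∑ g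
∑-cong {n} h = sumOf-cong h (allFin n)

upper : ∀ {n} → (Fin n → Fin n → ℕ) → ℕ
upper h = ∑ λ i → ∑ λ j → if does (toℕ i <? toℕ j) then h i j else 0

offDiagonal : ∀ {n} → (Fin n → Fin n → ℕ) → ℕ
offDiagonal h = ∑ λ i → ∑ λ j → if does (i ≟ᶠ j) then 0 else h i j

-- An injection need not preserve the order of the vertices, and sums over i < j are awkward to
-- transport. Twice such a sum is a sum over all ordered pairs of distinct vertices, where the order
-- is irrelevant.
upper-double : ∀ {n} {h : Fin n → Fin n → ℕ} → (∀ i j → h i j ≡ h j i) → upper h + upper h ≡ offDiagonal h
upper-double {n} {h} h-sym = begin
  upper h + upper h                         ≡⟨ cong (upper h +_) (sumOf-swap u (allFin n) (allFin n)) ⟩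
  upper h + ∑ (λ i → ∑ λ j → u j i)         ≡⟨ sumOf-+ (λ i → ∑ (u i)) (λ i → ∑ λ j → u j i) (allFin n) ⟨
  ∑ (λ i → ∑ (u i) + ∑ λ j → u j i)         ≡⟨ ∑-cong (λ i → trans (sym (sumOf-+ (u i) (λ j → u j i) (allFin n))) (∑-cong (pointwise i))) ⟩
  offDiagonal h                             ∎
  where
  open ≡-Reasoning
  u : Fin n → Fin n → ℕ
  u i j = if does (toℕ i <? toℕ j) then h i j else 0
  pointwise : ∀ i j → u i j + u j i ≡ (if does (i ≟ᶠ j) then 0 else h i j)
  pointwise i j with i ≟ᶠ j | <-cmp (toℕ i) (toℕ j)
  ... | yes refl | _ rewrite dec-false (toℕ i <? toℕ i) (<-irrefl refl) = refl
  ... | no  _    | tri< i<j _ j≮i rewrite dec-true (toℕ i <? toℕ j) i<j | dec-false (toℕ j <? toℕ i) j≮i = +-identityʳ (h i j)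
  ... | no  i≢j  | tri≈ _ i≡j _ = ⊥-elim (i≢j (toℕ-injective i≡j))
  ... | no  _    | tri> i≮j _ j<i rewrite dec-false (toℕ i <? toℕ j) i≮j | dec-true (toℕ j <? toℕ i) j<i = h-sym j i

S-pull-≤ : ∀ {n s} (J : Multigraph n) {f : Fin s → Fin n} → Injective _≡_ _≡_ f →
  ∀ {X} → (∀ a → f a ∈ X) → S (pull J f) ≤ S[ J ] X
S-pull-≤ {n} {s} J {f} inj {X} f∈X = halve (begin
  upper wf + upper wf                         ≡⟨ upper-double (λ a b → Multigraph.sym J (f a) (f b)) ⟩
  offDiagonal wf                              ≤⟨ ∑-mono (λ a → ≤-trans (∑-mono (pointwise a)) (∑-injective inj (g (f a)))) ⟩
  ∑ (λ a → ∑ (g (f a)))                       ≤⟨ ∑-injective inj (λ i → ∑ (g i)) ⟩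
  offDiagonal wX                              ≡⟨ upper-double wX-sym ⟨
  upper wX + upper wX                         ≡⟨ cong₂ _+_ upper-wX upper-wX ⟩
  S[ J ] X + S[ J ] X                         ∎)
  where
  open ≤-Reasoning
  wf : Fin s → Fin s → ℕ
  wf a b = w J (f a) (f b)
  wX : Fin n → Fin n → ℕ
  wX i j = if does (i ∈? X) ∧ does (j ∈? X) then w J i j else 0
  wX-sym : ∀ i j → wX i j ≡ wX j i
  wX-sym i j rewrite ∧-comm (does (i ∈? X)) (does (j ∈? X)) | Multigraph.sym J i j = refl
  g : Fin n → Fin n → ℕ
  g i j = if does (i ≟ᶠ j) then 0 else wX i j
  pointwise : ∀ a b → (if does (a ≟ᶠ b) then 0 else wf a b) ≤ g (f a) (f b)
  pointwise a b with a ≟ᶠ b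
  ... | yes _ = z≤n
  ... | no a≢b rewrite dec-false (f a ≟ᶠ f b) (a≢b ∘ inj) | dec-true (f a ∈? X) (f∈X a) | dec-true (f b ∈? X) (f∈X b) = ≤-refl
  upper-wX : upper wX ≡ S[ J ] X
  upper-wX = ∑-cong λ i → ∑-cong λ j → nested (does (toℕ i <? toℕ j)) (does (i ∈? X) ∧ does (j ∈? X)) (w J i j)
    where
    nested : ∀ a b (x : ℕ) → (if a then (if b then x else 0) else 0) ≡ (if a ∧ b then x else 0)
    nested true  _ _ = refl
    nested false _ _ = refl
  halve : ∀ {a b} → a + a ≤ b + b → a ≤ b
  halve {a} {b} h with a ≤? b
  ... | yes a≤b = a≤b
  ... | no  a≰b = ⊥-elim (<⇒≱ (+-mono-< (≰⇒> a≰b) (≰⇒> a≰b)) h)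

upper-mono : ∀ {n} {g h : Fin n → Fin n → ℕ} → (∀ i j → toℕ i < toℕ j → g i j ≤ h i j) → upper g ≤ upper h
upper-mono {n} {g} {h} g≤h = ∑-mono (λ i → ∑-mono (pointwise i))
  where
  pointwise : ∀ i j → (if does (toℕ i <? toℕ j) then g i j else 0) ≤ (if does (toℕ i <? toℕ j) then h i j else 0)
  pointwise i j with toℕ i <ᵇ toℕ j in eq
  ... | true  = g≤h i j (<ᵇ⇒< _ _ (subst T (sym eq) tt))
  ... | false = z≤n

term≤upper : ∀ {n} (h : Fin n → Fin n → ℕ) i j → toℕ i < toℕ j → h i j ≤ upper h
term≤upper {n} h i j i<j = begin
  h i j         ≡⟨ cong (λ c → if c then h i j else 0) (dec-true (toℕ i <? toℕ j) i<j) ⟨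
  u i j         ≤⟨ term≤∑ (u i) j ⟩
  ∑ (u i)       ≤⟨ term≤∑ (λ i → ∑ (u i)) i ⟩
  upper h       ∎
  where
  open ≤-Reasoning
  u : Fin n → Fin n → ℕ
  u i j = if does (toℕ i <? toℕ j) then h i j else 0

S-pull-≤q : ∀ {n s q} {J : Multigraph n} → IsSQGraph s q J → (v : Vec (Fin n) s) → UniqueVec v → S (pull J (lookup v)) ≤ q
S-pull-≤q {J = J} sq v uniq =
  ≤-trans (S-pull-≤ J (λ {a} {b} → UniqueVecP.lookup-injective uniq a b) (lookup∈image v)) (sq (image v) (∣image∣ uniq))

S-pull-cong : ∀ {n s} (G : Multigraph n) {f g : Fin s → Fin n} → f ≗ g → S (pull G f) ≡ S (pull G g)
S-pull-cong G f≗g = ∑-cong λ a → ∑-cong λ b →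
  cong₂ (λ x y → if does (toℕ a <? toℕ b) then w G x y else 0) (f≗g a) (f≗g b)

transpose-fst : ∀ {n} (i j : Fin n) → transpose i j i ≡ j
transpose-fst i j rewrite dec-true (i ≟ᶠ i) refl = refl

transpose-fixed : ∀ {n} {i j k : Fin n} → k ≢ i → k ≢ j → transpose i j k ≡ k
transpose-fixed {i = i} {j} {k} k≢i k≢j rewrite dec-false (k ≟ᶠ i) k≢i | dec-false (k ≟ᶠ j) k≢j = refl

transpose-injective : ∀ {n} (i j : Fin n) → Injective _≡_ _≡_ (transpose i j)
transpose-injective i j eq = trans (sym (transpose-inverse j i)) (trans (cong (transpose j i) eq) (transpose-inverse j i))

-- Start from the standard embedding. One transposition sends the image of 0 to `i`; a second sends
-- the resulting image `b` of 1 to `j`, fixing `i` because `i` differs from both `b` and `j`.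
extend-pair : ∀ {n s} → suc (suc s) ≤ n → (i j : Fin n) → i ≢ j →
  ∃[ f ] (Injective _≡_ _≡_ f × f (zero {suc s}) ≡ i × f (suc zero) ≡ j)
extend-pair s≤n i j i≢j = f , f-injective , f0 , transpose-fst b j
  where
  ι = λ a → inject≤ a s≤n
  ι-injective : Injective _≡_ _≡_ ι
  ι-injective {a} {b} = inject≤-injective s≤n s≤n a b
  τ = transpose (ι zero) i
  b = τ (ι (suc zero))
  f = λ a → transpose b j (τ (ι a))
  f-injective : Injective _≡_ _≡_ f
  f-injective = ι-injective ∘ transpose-injective (ι zero) i ∘ transpose-injective b j
  i≢b : i ≢ b
  i≢b i≡b with ι-injective {zero} {suc zero} (transpose-injective (ι zero) i (trans (transpose-fst (ι zero) i) i≡b))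
  ... | ()
  f0 : f zero ≡ i
  f0 = trans (cong (transpose b j) (transpose-fst (ι zero) i)) (transpose-fixed i≢b i≢j)

-- Any pair extends to `s` distinct vertices, and its weight is one term of a sum that is at most
-- `q`.
IsSQGraph⇒MultAtMost : ∀ {n s q} → 2 ≤ s → s ≤ n → {J : Multigraph n} → IsSQGraph s q J → MultAtMost q J
IsSQGraph⇒MultAtMost {s = suc (suc s)} {q} (s≤s (s≤s z≤n)) s≤n {J} sq i j i≢j with extend-pair s≤n i j i≢j
... | f , f-injective , refl , refl = begin
  w J (f zero) (f (suc zero))          ≤⟨ term≤upper (λ a b → w J (f a) (f b)) zero (suc zero) (s≤s z≤n) ⟩
  S (pull J f)                         ≡⟨ S-pull-cong J (λ a → sym (lookup∘tabulate f a)) ⟩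
  S (pull J (lookup (tabulate f)))     ≤⟨ S-pull-≤q {J = J} sq (tabulate f) (UniqueVecP.tabulate⁺ f-injective) ⟩
  q                                    ∎
  where open ≤-Reasoning

-- Counting overweight sets by tuples

unique? : ∀ {n s} (v : Vec (Fin n) s) → Dec (UniqueVec v)
unique? = VecPairs.allPairs? (λ x y → ¬? (x ≟ᶠ y))

overweight : ∀ {n s} → ℕ → Multigraph n → Vec (Fin n) s → Bool
overweight q G v = ⌊ unique? v ⌋ ∧ (q <ᵇ S (pull G (lookup v)))

vectors : ∀ n s → List (Vec (Fin n) s)
vectors n zero    = [] ∷ []
vectors n (suc s) = concatMap (λ x → map (x ∷_) (vectors n s)) (allFin n)

∈-vectors : ∀ {n s} (v : Vec (Fin n) s) → v ∈ˡ vectors n s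
∈-vectors []      = here refl
∈-vectors {n} {suc s} (x ∷ v) = ∈-concatMap⁺ (λ x → map (x ∷_) (vectors n s))
  (Any.map (λ { refl → ∈-map⁺ (x ∷_) (∈-vectors v) }) (∈-allFin x))

sumOf-vectors : ∀ {n} s (D : Vec (Fin n) s → Bool) → sumOf (𝟙 ∘ D) (vectors n s) ≡ cnt s D
sumOf-vectors zero    D = +-identityʳ _
sumOf-vectors {n} (suc s) D = trans (sumOf-concatMap (𝟙 ∘ D) (λ x → map (x ∷_) (vectors n s)) (allFin n))
  (∑-cong λ x → trans (sumOf-map (𝟙 ∘ D) (x ∷_) (vectors n s)) (sumOf-vectors s (λ v → D (x ∷ v))))

length≤cnt : ∀ {n s} (D : Vec (Fin n) s → Bool) {vs} → Unique vs → All (T ∘ D) vs → length vs ≤ cnt s D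
length≤cnt {n} {s} D {vs} uniq all = begin
  length vs                     ≤⟨ length≤sumOf all ⟩
  sumOf (𝟙 ∘ D) vs              ≤⟨ sumOf-unique-⊆ (𝟙 ∘ D) uniq (vectors n s) (λ {v} _ → ∈-vectors v) ⟩
  sumOf (𝟙 ∘ D) (vectors n s)   ≡⟨ sumOf-vectors s D ⟩
  cnt s D                       ∎
  where
  open ≤-Reasoning
  length≤sumOf : ∀ {vs} → All (T ∘ D) vs → length vs ≤ sumOf (𝟙 ∘ D) vs
  length≤sumOf [] = z≤n
  length≤sumOf {v ∷ _} (Dv ∷ rest) with D v
  ... | true = s≤s (length≤sumOf rest)

-- One ordering is chosen for each set. Having `Xs` as the list of images lets distinctness of the
-- sets pass back to the tuples.
tuples : ∀ {n s q} (G : Multigraph n) {Xs} → All (InH G s q) Xs →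
  ∃[ vs ] (map image vs ≡ Xs × All (T ∘ overweight {n} {s} q G) vs)
tuples G [] = [] , refl , []
tuples {s = s} {q} G {X ∷ _} ((∣X∣≡s , f , f-injective , f∈X , _ , heavy) ∷ rest) with tuples G rest
... | vs , eq , all = tabulate f ∷ vs ,
  cong₂ _∷_ (image≡ uniq ∣X∣≡s (λ a → subst (_∈ X) (sym (lookup∘tabulate f a)) (f∈X a))) eq ,
  Equivalence.from T-∧ (fromWitness uniq , <⇒<ᵇ (subst (q <_) (S-pull-cong G (λ a → sym (lookup∘tabulate f a))) heavy)) ∷ all
  where
  uniq : UniqueVec (tabulate f)
  uniq = UniqueVecP.tabulate⁺ f-injective

length≤overweight : ∀ {n s q} (G : Multigraph n) {Xs} → Unique Xs → All (InH G s q) Xs →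
  length Xs ≤ cnt s (overweight q G)
length≤overweight G uniq all with tuples G all
... | vs , refl , heavy = ≤-trans (≤-reflexive (length-map image vs)) (length≤cnt _ (UniqueP.map⁻ uniq) heavy)

-- Binomial coefficients and the density bound

-- Induction along Pascal's rule, which avoids factorials and division.
C-absorption : ∀ n k → suc k * (suc n C suc k) ≡ suc n * (n C k)
C-absorption zero    zero    = refl
C-absorption zero    (suc k) = *-zeroʳ (suc (suc k))
C-absorption (suc n) zero    = trans (*-identityˡ _) (trans (nC1≡n (suc (suc n))) (sym (*-identityʳ _)))
C-absorption (suc n) (suc k) = begin
  suc (suc k) * (suc (suc n) C suc (suc k))                           ≡⟨ cong (suc (suc k) *_) (nCk+nC[k+1]≡[n+1]C[k+1] (suc n) (suc k)) ⟨
  suc (suc k) * (c + (suc n C suc (suc k)))                           ≡⟨ expand (suc k) c (suc n C suc (suc k)) ⟩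
  c + (suc k * c + suc (suc k) * (suc n C suc (suc k)))               ≡⟨ cong (λ z → c + z) (cong₂ _+_ (C-absorption n k) (C-absorption n (suc k))) ⟩
  c + (suc n * (n C k) + suc n * (n C suc k))                         ≡⟨ cong (c +_) (*-distribˡ-+ (suc n) (n C k) (n C suc k)) ⟨
  c + suc n * (n C k + n C suc k)                                     ≡⟨ cong (λ z → c + suc n * z) (nCk+nC[k+1]≡[n+1]C[k+1] n k) ⟩
  suc (suc n) * c                                                     ∎
  where
  open ≡-Reasoning
  c = suc n C suc k
  expand : ∀ k c d → suc k * (c + d) ≡ c + (k * c + suc k * d)
  expand = solve-∀

^-distribʳ-* : ∀ m n k → (m * n) ^ k ≡ m ^ k * n ^ k
^-distribʳ-* m n zero    = refl
^-distribʳ-* m n (suc k) rewrite ^-distribʳ-* m n k = interchange m n (m ^ k) (n ^ k)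
  where
  interchange : ∀ a b c d → a * b * (c * d) ≡ a * c * (b * d)
  interchange = solve-∀

n^n≢0 : ∀ n → NonZero (n ^ n)
n^n≢0 zero    = _
n^n≢0 (suc n) = m^n≢0 (suc n) (suc n)

-- For k ≤ n one has (n+1)k ≤ (k+1)n. Its k-th power reduces the claim for n+1 and k+1 to that for
-- `n` and `k`, and absorption raises the binomial coefficient; the auxiliary factor k^k is
-- cancelled at the end.
n^k≤k^k*nCk : ∀ {n k} → k ≤ n → n ^ k ≤ k ^ k * (n C k)
n^k≤k^k*nCk {n} {zero} _ = ≤-refl
n^k≤k^k*nCk {suc n} {suc k} (s≤s k≤n) = *-cancelʳ-≤ _ _ (k ^ k) {{n^n≢0 k}} (begin
  suc n * suc n ^ k * k ^ k             ≡⟨ trans (*-assoc (suc n) (suc n ^ k) (k ^ k)) (cong (suc n *_) (sym (^-distribʳ-* (suc n) k k))) ⟩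
  suc n * (suc n * k) ^ k               ≤⟨ *-monoʳ-≤ (suc n) (^-monoˡ-≤ k (+-mono-≤ k≤n (≤-reflexive (*-comm n k)))) ⟩
  suc n * (suc k * n) ^ k               ≡⟨ cong (suc n *_) (^-distribʳ-* (suc k) n k) ⟩
  suc n * (suc k ^ k * n ^ k)           ≤⟨ *-monoʳ-≤ (suc n) (*-monoʳ-≤ (suc k ^ k) (n^k≤k^k*nCk k≤n)) ⟩
  suc n * (suc k ^ k * (k ^ k * (n C k))) ≡⟨ pull-out (suc n) (suc k ^ k) (k ^ k) (n C k) ⟩
  suc k ^ k * k ^ k * (suc n * (n C k)) ≡⟨ cong (suc k ^ k * k ^ k *_) (C-absorption n k) ⟨
  suc k ^ k * k ^ k * (suc k * (suc n C suc k)) ≡⟨ regroup (suc k) (suc k ^ k) (k ^ k) (suc n C suc k) ⟩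
  suc k ^ suc k * (suc n C suc k) * k ^ k ∎)
  where
  open ≤-Reasoning
  pull-out : ∀ a b c d → a * (b * (c * d)) ≡ b * c * (a * d)
  pull-out = solve-∀
  regroup : ∀ a b c d → b * c * (a * d) ≡ a * b * d * c
  regroup = solve-∀

-- A positive rational with denominator d is at least 1/d.
↧ₙδ*m≤n⇒m≤δ*n : ∀ {δ} → 0ℚ <ℚ δ → ∀ {m n} → ↧ₙ δ * m ≤ n → ℕtoℚ m ≤ℚ δ *ℚ ℕtoℚ n
↧ₙδ*m≤n⇒m≤δ*n {δ@(mkℚ (pos (suc p)) d-1 _)} _ {m} {n} dm≤n = ℚP.toℚᵘ-cancel-≤
  (ℚᵘP.≤-respˡ-≃ (ℚᵘP.≃-sym (ℚP.toℚᵘ-fromℚᵘ (mkℚᵘ (pos m) 0)))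
    (ℚᵘP.≤-respʳ-≃ (ℚᵘP.≃-sym (ℚᵘP.≃-trans (ℚP.toℚᵘ-homo-* δ (ℕtoℚ n))
        (ℚᵘP.*-congˡ {mkℚᵘ (pos (suc p)) d-1} (ℚP.toℚᵘ-fromℚᵘ (mkℚᵘ (pos n) 0)))))
      (*≤* (subst (ℤ._≤ _) (ℤP.pos-* m _) (subst (_ ℤ.≤_)
        (trans (ℤP.pos-* (suc p * n) 1) (cong (ℤ._* pos 1) (ℤP.pos-* (suc p) n)))
        (ℤ.+≤+ bound))))))
  where
  open ≤-Reasoning
  bound : m * (suc d-1 * 1) ≤ suc p * n * 1
  bound = begin
    m * (suc d-1 * 1)  ≡⟨ trans (cong (m *_) (*-identityʳ (suc d-1))) (*-comm m (suc d-1)) ⟩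
    suc d-1 * m        ≤⟨ dm≤n ⟩
    n                  ≤⟨ m≤n*m n (suc p) ⟩
    suc p * n          ≡⟨ *-identityʳ (suc p * n) ⟨
    suc p * n * 1      ∎
↧ₙδ*m≤n⇒m≤δ*n {mkℚ (pos zero)   _ _} (*<* (ℤ.+<+ ()))
↧ₙδ*m≤n⇒m≤δ*n {mkℚ (-[1+ _ ]) _ _} (*<* ())

few-overweight⇒HBound : ∀ {n s q δ} → 0ℚ <ℚ δ → s ≤ n → (G : Multigraph n) →
  ↧ₙ δ * s ^ s * cnt s (overweight q G) ≤ n ^ s → HBound δ s q G
few-overweight⇒HBound {n} {s} {q} {δ} 0<δ s≤n G few L uniq all = ↧ₙδ*m≤n⇒m≤δ*n 0<δ
  (*-cancelˡ-≤ (s ^ s) {{n^n≢0 s}} (begin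
    s ^ s * (↧ₙ δ * length L)               ≡⟨ regroup (s ^ s) (↧ₙ δ) (length L) ⟩
    ↧ₙ δ * s ^ s * length L                 ≤⟨ *-monoʳ-≤ (↧ₙ δ * s ^ s) (length≤overweight G uniq all) ⟩
    ↧ₙ δ * s ^ s * cnt s (overweight q G)   ≤⟨ few ⟩
    n ^ s                                    ≤⟨ n^k≤k^k*nCk s≤n ⟩
    s ^ s * (n C s)                          ∎))
  where
  open ≤-Reasoning
  regroup : ∀ a b c → a * (b * c) ≡ b * a * c
  regroup = solve-∀

-- Containers for multigraphs

lookup-pairs : ∀ {A : Set} {R : A → A → Set} {s} {v : Vec A s} → VecPairs.AllPairs R v →
  ∀ a b → toℕ a < toℕ b → R (lookup v a) (lookup v b)
lookup-pairs (x∼v ∷ _) zero    (suc b) _         = VecAllP.lookup⁺ x∼v b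
lookup-pairs (_ ∷ prs) (suc a) (suc b) (s≤s a<b) = lookup-pairs prs a b a<b

-- Saturated on the diagonal, so that a set avoiding it consists of proper pairs.
saturated : ∀ {n} → Multigraph n → Multigraph n → Graph n
saturated G J x y = does (x ≟ᶠ y) ∨ (w G x y ≤ᵇ w J x y)

-- On a clique `J` is at least `G` on every pair, so an overweight tuple of `G` would be overweight
-- for `J`.
saturated-NoClique : ∀ {n s q} {G J : Multigraph n} → IsSQGraph s q J → NoClique (overweight {s = s} q G) (saturated G J)
saturated-NoClique {q = q} {G} {J} sq v heavy clique with Equivalence.to T-∧ heavy
... | uniq , q<S = <⇒≱ (<ᵇ⇒< q _ q<S) (≤-trans (upper-mono G≤J) (S-pull-≤q {J = J} sq v uniq′))
  where
  uniq′ : UniqueVec v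
  uniq′ = toWitness uniq
  G≤J : ∀ a b → toℕ a < toℕ b → w G (lookup v a) (lookup v b) ≤ w J (lookup v a) (lookup v b)
  G≤J a b a<b with lookup v a ≟ᶠ lookup v b | lookup-pairs clique a b a<b
  ... | yes va≡vb | _   = ⊥-elim (<⇒≢ a<b (cong toℕ (UniqueVecP.lookup-injective uniq′ a b va≡vb)))
  ... | no  _     | sat = ≤ᵇ⇒≤ _ _ sat

-- `R` need not be symmetric: a pair loses one, and only one, as soon as either orientation lies in
-- `R`.
lower : ∀ {n} → Multigraph n → Graph n → Multigraph n
lower G R = record
  { w   = λ x y → if R x y ∨ R y x then w G x y ∸ 1 else w G x y
  ; sym = λ x y → cong₂ (λ b m → if b then m ∸ 1 else m) (∨-comm (R x y) (R y x)) (Multigraph.sym G x y)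
  }

unsaturated : ∀ {n} {G J : Multigraph n} {R : Graph n} → (∀ x → saturated G J x ⟂ R x) →
  ∀ x y → T (R x y) → w J x y < w G x y
unsaturated avoids x y Rxy = ≰⇒> λ G≤J → avoids x y Rxy (Equivalence.from T-∨ (inj₂ (≤⇒≤ᵇ G≤J)))

⊑-lower : ∀ {n} {G J : Multigraph n} {R : Graph n} → (∀ x → saturated G J x ⟂ R x) → J ⊑ G → J ⊑ lower G R
⊑-lower {G = G} {J} {R} avoids J⊑G x y x≢y with R x y in eq | R y x in eq′
... | true  | _     = ∸-monoˡ-≤ 1 (unsaturated {G = G} {J} {R} avoids x y (subst T (sym eq) tt))
... | false | true  rewrite Multigraph.sym J x y | Multigraph.sym G x y =
  ∸-monoˡ-≤ 1 (unsaturated {G = G} {J} {R} avoids y x (subst T (sym eq′) tt))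
... | false | false = J⊑G x y x≢y

total : ∀ {n} → Multigraph n → ℕ
total G = ∑ λ x → ∑ (w G x)

-- On `R` the weight of `G` exceeds that of `J`, hence is positive, and truncated subtraction really
-- removes one.
total-lower : ∀ {n} {G J : Multigraph n} {R : Graph n} → (∀ x → saturated G J x ⟂ R x) →
  total (lower G R) + ∑ (λ x → ∣ R x ∣ᵇ) ≤ total G
total-lower {n} {G} {J} {R} avoids = ≤-trans
  (≤-reflexive (sym (sumOf-+ (λ x → ∑ (w (lower G R) x)) (λ x → ∣ R x ∣ᵇ) (allFin n))))
  (∑-mono λ x → ≤-trans (≤-reflexive (sym (sumOf-+ (w (lower G R) x) (𝟙 ∘ R x) (allFin n)))) (∑-mono (pointwise x)))
  where
  pointwise : ∀ x y → w (lower G R) x y + 𝟙 (R x y) ≤ w G x y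
  pointwise x y with R x y in eq
  ... | true  = ≤-reflexive (m∸n+n≡m (≤-trans (s≤s z≤n) (unsaturated {G = G} {J} {R} avoids x y (subst T (sym eq) tt))))
  ... | false = ≤-trans (≤-reflexive (+-identityʳ _)) (decrease (R y x))
    where
    decrease : ∀ b → (if b then w G x y ∸ 1 else w G x y) ≤ w G x y
    decrease true  = m∸n≤m _ 1
    decrease false = ≤-refl

module MultigraphContainers (n t e L : ℕ) (2≤n : 2 ≤ n) (t*e≤n : t * e ≤ n) (n<t*[1+e] : n < t * suc e)
  (2L≤t : 2 * L ≤ t) (s q : ℕ) (s≤n : s ≤ n) (t^i≤e : ∀ i → i < s → t ^ i ≤ e) (δ : ℚ) (0<δ : 0ℚ <ℚ δ)
  (K≤L : 2 * (2 ^ s * (↧ₙ δ * s ^ s)) ≤ L) where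

  open Covering n 2≤n
  open Containers n t e L 2≤n t*e≤n n<t*[1+e] 2L≤t

  Container : Set
  Container = ∃[ G ] (MultAtMost {n} q G × HBound δ s q G)

  Below : Multigraph n → Multigraph n → Set
  Below G J = IsSQGraph s q J × J ⊑ G

  -- Each lowering takes at least n²/(2L)² off the total weight, which bounds the number of rounds
  -- by `f`; for `f = 0` the hypothesis on the total is absurd. Once overweight tuples are few, `G`
  -- itself is the container.
  Cov-Below : ∀ f G → (∀ x y → w G x y ≤ q) → 2 * L * (2 * L) * total G < f * (n * n) →
    Cov (Below G) (λ J (C : Container) → J ⊑ proj₁ C) (f * (β s * (n * e)))
  Cov-Below (suc f) G G≤q fuel with n ^ s ≤? ↧ₙ δ * s ^ s * cnt s (overweight q G)
  ... | no  few  = Cov-one (G , (λ x y _ → G≤q x y) , few-overweight⇒HBound 0<δ s≤n G (<⇒≤ (≰⇒> few)))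
                     (λ _ → proj₂)
  ... | yes many = Cov-bind
    (Cov-mono {P′ = Below G} (λ J below → saturated-NoClique {G = G} {J} (proj₁ below)) (λ _ _ _ r → r) ≤-refl
      (Cov-via (saturated G) (Cov-NoClique s (↧ₙ δ * s ^ s) (overweight q G) many K≤L t^i≤e)))
    (λ R → Cov-mono
      (λ { J ((sq , J⊑G) , avoids , large) → fuel′ {J} {R} avoids large , sq , ⊑-lower {G = G} {J} {R} avoids J⊑G })
      (λ _ _ _ r → r) ≤-refl
      -- The drop in total weight concerns `G` and `R` only, but is derived from some `J` in the
      -- class. An `R` failing the test therefore covers nothing.
      (Cov-given (2 * L * (2 * L) * total (lower G R) <? f * (n * n)) (Cov-Below f (lower G R) (lower≤q R))))
    where
    open ≤-Reasoning
    Λ = 2 * L * (2 * L)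
    lower≤q : ∀ R x y → w (lower G R) x y ≤ q
    lower≤q R x y with R x y ∨ R y x
    ... | true  = ≤-trans (m∸n≤m _ 1) (G≤q x y)
    ... | false = G≤q x y
    fuel′ : ∀ {J R} → (∀ x → saturated G J x ⟂ R x) → n * n ≤ Λ * ∑ (λ x → ∣ R x ∣ᵇ) →
      Λ * total (lower G R) < f * (n * n)
    fuel′ {J} {R} avoids large = +-cancelʳ-< (n * n) _ _ (begin-strict
      Λ * total (lower G R) + n * n                        ≤⟨ +-monoʳ-≤ _ large ⟩
      Λ * total (lower G R) + Λ * ∑ (λ x → ∣ R x ∣ᵇ)        ≡⟨ *-distribˡ-+ Λ _ _ ⟨
      Λ * (total (lower G R) + ∑ (λ x → ∣ R x ∣ᵇ))          ≤⟨ *-monoʳ-≤ Λ (total-lower {G = G} {J} {R} avoids) ⟩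
      Λ * total G                                          <⟨ fuel ⟩
      n * n + f * (n * n)                                  ≡⟨ +-comm (n * n) _ ⟩
      f * (n * n) + n * n                                  ∎)

  complete : Multigraph n
  complete = record { w = λ _ _ → q ; sym = λ _ _ → refl }

  Cov-IsSQGraph : 2 ≤ s → Cov (IsSQGraph s q) (λ J (C : Container) → J ⊑ proj₁ C)
    (suc (2 * L * (2 * L) * q) * (β s * (n * e)))
  Cov-IsSQGraph 2≤s = Cov-mono (λ J sq → sq , IsSQGraph⇒MultAtMost 2≤s s≤n {J} sq) (λ _ _ _ r → r) ≤-refl
    -- The complete multigraph has total n²q, and the additional round makes the bound strict.
    (Cov-Below (suc (2 * L * (2 * L) * q)) complete (λ _ _ → ≤-refl) (begin-strict
      Λ * total complete          ≤⟨ *-monoʳ-≤ Λ (∑-≤ {n} (λ _ → ∑-≤ {n} (λ _ → ≤-refl {q}))) ⟩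
      Λ * (n * (n * q))           ≡⟨ regroup Λ n q ⟩
      0 + Λ * q * (n * n)         <⟨ +-monoˡ-< (Λ * q * (n * n)) (*-mono-< 0<n 0<n) ⟩
      n * n + Λ * q * (n * n)     ∎))
    where
    open ≤-Reasoning
    Λ = 2 * L * (2 * L)
    0<n : 0 < n
    0<n = ≤-trans (s≤s z≤n) 2≤n
    regroup : ∀ a n q → a * (n * (n * q)) ≡ a * q * (n * n)
    regroup = solve-∀

-- Choice of parameters and the final count

nth-root : ∀ p .{{_ : NonZero p}} n → ∃[ t ] (t ^ p ≤ n × n < suc t ^ p)
nth-root p@(suc _) zero = 0 , z≤n , m^n>0 1 p
nth-root p (suc n) with nth-root p n
... | t , t^p≤n , n<[1+t]^p with suc t ^ p ≤? suc n
...   | yes ≤n = suc t , ≤n , ≤-trans (s≤s n<[1+t]^p) (^-monoˡ-< p (n<1+n (suc t)))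
...   | no  ≰n = t , m≤n⇒m≤1+n t^p≤n , ≰⇒> ≰n

^-cancelʳ-≤ : ∀ {m n} p .{{_ : NonZero p}} → m ^ p ≤ n ^ p → m ≤ n
^-cancelʳ-≤ {m} {n} p h = ≮⇒≥ λ n<m → <⇒≱ (^-monoˡ-< p n<m) h

-- The hypothesis on `k` says k ≥ n^(2 - 1/(4s)), and t + 1 exceeds n^(1/(4s)). Hence net ≤ n² ≤ k(t
-- + 1) ≤ 2kt.
n*e≤2*k : ∀ {n t e k s} → 1 ≤ s → 1 ≤ t → t * e ≤ n → n < suc t ^ (4 * s) →
  n ^ (8 * s ∸ 1) ≤ k ^ (4 * s) → n * e ≤ 2 * k
n*e≤2*k {n} {t} {e} {k} {s} 1≤s 1≤t t*e≤n n<[1+t]^4s n^≤k^ = *-cancelʳ-≤ _ _ t {{>-nonZero 1≤t}} (begin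
  n * e * t          ≡⟨ trans (*-assoc n e t) (cong (n *_) (*-comm e t)) ⟩
  n * (t * e)        ≤⟨ *-monoʳ-≤ n t*e≤n ⟩
  n * n              ≡⟨ cong (n *_) (*-identityʳ n) ⟨
  n ^ 2              ≤⟨ ^-cancelʳ-≤ (4 * s) {{>-nonZero (≤-trans 1≤s (m≤n*m s 4))}} powers ⟩
  k * suc t          ≤⟨ *-monoʳ-≤ k (+-monoˡ-≤ t 1≤t) ⟩
  k * (t + t)        ≡⟨ double k t ⟩
  2 * k * t          ∎)
  where
  open ≤-Reasoning
  double : ∀ k t → k * (t + t) ≡ 2 * k * t
  double = solve-∀
  8s : ∀ s → 2 * (4 * s) ≡ 8 * s
  8s = solve-∀
  powers : (n ^ 2) ^ (4 * s) ≤ (k * suc t) ^ (4 * s)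
  powers = begin
    (n ^ 2) ^ (4 * s)                ≡⟨ trans (^-*-assoc n 2 (4 * s)) (cong (n ^_) (8s s)) ⟩
    n ^ (8 * s)                      ≡⟨ cong (n ^_) (m∸n+n≡m {8 * s} {1} (≤-trans 1≤s (m≤n*m s 8))) ⟨
    n ^ (8 * s ∸ 1 + 1)              ≡⟨ ^-distribˡ-+-* n (8 * s ∸ 1) 1 ⟩
    n ^ (8 * s ∸ 1) * n ^ 1          ≤⟨ *-mono-≤ n^≤k^ (≤-trans (≤-reflexive (*-identityʳ n)) (<⇒≤ n<[1+t]^4s)) ⟩
    k ^ (4 * s) * suc t ^ (4 * s)    ≡⟨ ^-distribʳ-* k (suc t) (4 * s) ⟨
    (k * suc t) ^ (4 * s)            ∎

-- Bound (iii) is exponentiated, with `k` ranging over all integers k ≥ n^(2 - 1/(4s)), so that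
-- neither real powers nor logarithms occur.
theorem3p5 : ∀ (δ : ℚ) → 0ℚ <ℚ δ → δ <ℚ 1ℚ → ∀ (s q : ℕ) → 2 ≤ s →
    ∃[ c ] (0 < c × ∃[ n₀ ] (∀ n → n₀ ≤ n →
    ∃[ 𝒢 ] (All (MultAtMost q) 𝒢 ×
    (∀ (J : Multigraph n) → IsSQGraph s q J → Any (J ⊑_) 𝒢) ×
    All (HBound δ s q) 𝒢 ×
    (∀ k → n ^ (8 * s ∸ 1) ≤ k ^ (4 * s) → length 𝒢 ≤ n ^ (c * k)))))
-- The exponent is at most M·ne ≤ 2Mk; the successor makes the constant positive. The threshold
-- ensures s ≤ n and, as `t` is the integer part of the 4s-th root of `n`, also 2L ≤ t.
theorem3p5 δ 0<δ _ s q 2≤s = suc (M * 2) , s≤s z≤n , (2 * L) ^ (4 * s) + s , containers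
  where
  open ≤-Reasoning
  -- Least value allowed when the recursion starts from s-tuples of density 1/K with K =
  -- `↧ₙ δ * s ^ s`.
  L = 2 * (2 ^ s * (↧ₙ δ * s ^ s))
  M = suc (2 * L * (2 * L) * q) * β s
  1≤s : 1 ≤ s
  1≤s = ≤-trans (n≤1+n 1) 2≤s
  instance
    s≢0 : NonZero s
    s≢0 = >-nonZero 1≤s
    4s≢0 : NonZero (4 * s)
    4s≢0 = m*n≢0 4 s
    L≢0 : NonZero L
    L≢0 = m*n≢0 2 _ {{_}} {{m*n≢0 (2 ^ s) _ {{m^n≢0 2 s}} {{m*n≢0 (↧ₙ δ) (s ^ s) {{_}} {{n^n≢0 s}}}}}}

  containers : ∀ n → (2 * L) ^ (4 * s) + s ≤ n →
    ∃[ 𝒢 ] (All (MultAtMost q) 𝒢 ×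
    (∀ (J : Multigraph n) → IsSQGraph s q J → Any (J ⊑_) 𝒢) ×
    All (HBound δ s q) 𝒢 ×
    (∀ k → n ^ (8 * s ∸ 1) ≤ k ^ (4 * s) → length 𝒢 ≤ n ^ (suc (M * 2) * k)))
  containers n n₀≤n = map proj₁ list
    , AllP.map⁺ (ListAll.universal (λ C → proj₁ (proj₂ C)) list)
    , (λ J sq → AnyP.map⁺ (cover J sq))
    , AllP.map⁺ (ListAll.universal (λ C → proj₂ (proj₂ C)) list)
    , λ k n^≤k^ → begin
        length (map proj₁ list)              ≡⟨ length-map proj₁ list ⟩
        length list                          ≤⟨ size ⟩
        n ^ (suc (2 * L * (2 * L) * q) * (β s * (n * e)))
          ≤⟨ ^-monoʳ-≤ n {{n≢0}} (exponent k (n*e≤2*k {s = s} 1≤s 1≤t t*e≤n n<[1+t]^4s n^≤k^)) ⟩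
        n ^ (suc (M * 2) * k)                ∎
    where
    root = nth-root (4 * s) n
    t = proj₁ root
    t^4s≤n : t ^ (4 * s) ≤ n
    t^4s≤n = proj₁ (proj₂ root)
    n<[1+t]^4s : n < suc t ^ (4 * s)
    n<[1+t]^4s = proj₂ (proj₂ root)
    s≤n : s ≤ n
    s≤n = ≤-trans (m≤n+m s _) n₀≤n
    n≢0 : NonZero n
    n≢0 = >-nonZero (≤-trans 1≤s s≤n)
    2L≤t : 2 * L ≤ t
    2L≤t = ≮⇒≥ λ t<2L → <⇒≱ n<[1+t]^4s (≤-trans (^-monoˡ-≤ (4 * s) t<2L) (≤-trans (m≤m+n _ s) n₀≤n))
    1≤t : 1 ≤ t
    1≤t = ≤-trans (>-nonZero⁻¹ L) (≤-trans (m≤m+n L (1 * L)) 2L≤t)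
    instance
      t≢0 : NonZero t
      t≢0 = >-nonZero 1≤t
    e = n / t
    t*e≤n : t * e ≤ n
    t*e≤n = ≤-trans (≤-reflexive (*-comm t e)) (m/n*n≤m n t)
    n<t*[1+e] : n < t * suc e
    n<t*[1+e] = begin-strict
      n                 ≡⟨ m≡m%n+[m/n]*n n t ⟩
      n % t + e * t     <⟨ +-monoˡ-< (e * t) (m%n<n n t) ⟩
      t + e * t         ≡⟨ *-comm (suc e) t ⟩
      t * suc e         ∎
    t^i≤e : ∀ i → i < s → t ^ i ≤ e
    t^i≤e i i<s = ≤-pred (*-cancelˡ-< t _ _ (begin-strict
      t ^ suc i         ≤⟨ ^-monoʳ-≤ t (≤-trans i<s (m≤n*m s 4)) ⟩
      t ^ (4 * s)       ≤⟨ t^4s≤n ⟩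
      n                 <⟨ n<t*[1+e] ⟩
      t * suc e         ∎))
    open MultigraphContainers n t e L (≤-trans 2≤s s≤n) t*e≤n n<t*[1+e] 2L≤t s q s≤n t^i≤e δ 0<δ ≤-refl using (Cov-IsSQGraph)
    open Covering.Cov (Cov-IsSQGraph 2≤s)
    exponent : ∀ k → n * e ≤ 2 * k → suc (2 * L * (2 * L) * q) * (β s * (n * e)) ≤ suc (M * 2) * k
    exponent k ne≤2k = begin
      suc (2 * L * (2 * L) * q) * (β s * (n * e))   ≡⟨ *-assoc (suc (2 * L * (2 * L) * q)) (β s) (n * e) ⟨
      M * (n * e)                                   ≤⟨ *-monoʳ-≤ M ne≤2k ⟩
      M * (2 * k)                                   ≡⟨ *-assoc M 2 k ⟨
      M * 2 * k                                     ≤⟨ m≤n+m (M * 2 * k) k ⟩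
      suc (M * 2) * k                               ∎
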